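{- Let $G$ be a finite simple graph that is claw-free (i.e., $G$ has no induced subgraph isomorphic to $K_{1,3}$) and has maximum degree $\Delta(G)\le 4$. Then $\chi_i'(G)\le 13$, i.e., $G$ admits an injective $13$-edge-coloring.
   Context: An injective $k$-edge-coloring of a graph $G$ is a map $\phi: E(G)\to\{1,2,\dots,k\}$ such that $\phi(e)\neq\phi(e')$ whenever the distinct edges $e,e'$ are at distance two (they share no endpoint and some edge of $G$ joins an endpoint of $e$ to an endpoint of $e'$, so that $e$, this joining edge, and $e'$ form a path of three edges) or $e$ and $e'$ lie in a common triangle of $G$. Edges that merely share an endpoint without lying in a common triangle may receive the same color. The injective chromatic index $\chi_i'(G)$ is the smallest $k$ such that $G$ has an injective $k$-edge-coloring. -}

module Defs where

open import Data.Nat using (ℕ; _≤_)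
open import Data.Fin using (Fin)
open import Data.List using (length; filter; allFin)
open import Data.Product using (_×_; Σ)
open import Data.Sum using (_⊎_)
open import Relation.Nullary using (¬_; Dec)
open import Relation.Binary.PropositionalEquality using (_≡_)
open import Level using (0ℓ)

record Graph (n : ℕ) : Set₁ where
  field
    Adj     : Fin n → Fin n → Set
    adj?    : (u v : Fin n) → Dec (Adj u v)
    irrefl  : ∀ {u} → ¬ Adj u u
    sym     : ∀ {u v} → Adj u v → Adj v u

  degree : Fin n → ℕ
  degree v = length (filter (adj? v) (allFin n))

  MaxDegreeAtMost : ℕ → Set
  MaxDegreeAtMost d = ∀ v → degree v ≤ d

  ClawFree : Set
  ClawFree = ∀ c x y z → Adj c x → Adj c y → Adj c z →
             ¬ x ≡ y → ¬ x ≡ z → ¬ y ≡ z →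
             ¬ ((¬ Adj x y) × (¬ Adj x z) × (¬ Adj y z))

  -- Two edges, given as (ordered) endpoint pairs {a,b} and {c,d},
  -- are in conflict for injective edge-colouring:
  -- (i) at distance two: no shared endpoint, and some endpoint of the
  --     first is adjacent to some endpoint of the second; or
  -- (ii) they lie in a common triangle: they share an endpoint, their other
  --     endpoints are distinct and adjacent.
  DistTwo : Fin n → Fin n → Fin n → Fin n → Set
  DistTwo a b c d =
    ¬ a ≡ c × ¬ a ≡ d × ¬ b ≡ c × ¬ b ≡ d ×
    (Adj a c ⊎ Adj a d ⊎ Adj b c ⊎ Adj b d)

  InTriangle : Fin n → Fin n → Fin n → Fin n → Set
  InTriangle a b c d =
    (a ≡ c × ¬ b ≡ d × Adj b d) ⊎ (a ≡ d × ¬ b ≡ c × Adj b c) ⊎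
    (b ≡ c × ¬ a ≡ d × Adj a d) ⊎ (b ≡ d × ¬ a ≡ c × Adj a c)

  Conflict : Fin n → Fin n → Fin n → Fin n → Set
  Conflict a b c d = DistTwo a b c d ⊎ InTriangle a b c d

  record InjectiveEdgeColoring (k : ℕ) : Set where
    field
      colour    : (u v : Fin n) → Adj u v → Fin k
      symmetric : ∀ u v (p : Adj u v) (q : Adj v u) → colour u v p ≡ colour v u q
      proper    : ∀ a b c d (p : Adj a b) (q : Adj c d) →
                  Conflict a b c d → ¬ colour a b p ≡ colour c d q

{-# OPTIONS --safe #-}
module Submission where

-- Colour the conflict graph on the edges greedily, removing edges with at most 12 conflicts, until a set F of
-- minimum conflict degree 13 is left. Claw-freeness and Δ ≤ 4 force every uv in F to lie in exactly one triangle
-- uvc, with N(u) = {v, c, a₁, a₂} and N(v) = {u, c, b₁, b₂}, where a₁a₂ and b₁b₂ are edges, c has no neighbour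
-- among the aᵢ and bⱼ, and at most one edge joins an aᵢ to a bⱼ (G looks locally like the line graph of a
-- triangle-free cubic graph). Then F has conflict degree at most 14 and contains no 7 pairwise conflicting edges.
-- Lovász's potential argument splits F into parts of degree at most 6 and 7, and Brooks' theorem, proved by
-- Zając's path argument, colours them with 6 and 7 colours.

open import Defs
open import Data.Nat using (ℕ; zero; suc; _+_; _*_; _∸_; _≤_; _<_; z≤n; s≤s; s≤s⁻¹; _≤?_; _<?_)
open import Data.Nat.Properties
open import Data.Nat.Solver using (module +-*-Solver)
open import Data.Nat.Induction using (<-wellFounded)
open import Induction.WellFounded using (Acc; acc)
open import Data.Fin using (Fin; splitAt; fromℕ<; _↑ˡ_; _↑ʳ_) renaming (_<_ to _<ᶠ_)
import Data.Fin.Properties as Fin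
open import Data.List using (List; []; _∷_; _++_; length; filter; map; allFin; cartesianProduct)
open import Data.List.Properties using (∷-injective; filter-notAll; filter-accept; filter-reject; filter-++; length-++; length-map; length-tabulate; ++-assoc; ++-identityʳ)
open import Data.List.Membership.Propositional using (_∈_; _∉_; find; lose)
open import Data.List.Membership.Propositional.Properties using (∈-∃++; ∈-++⁺ˡ; ∈-++⁺ʳ; ∈-++⁻; ∈-filter⁺; ∈-filter⁻; ∈-map⁺; ∈-allFin; ∈-insert; ∈-AllPairs₂; ∈-cartesianProduct⁺)
open import Data.List.Relation.Binary.Subset.Propositional using (_⊆_)
open import Data.List.Relation.Binary.Permutation.Propositional using (_↭_; ↭-sym; ↭-trans; ↭-refl; ↭-reflexive; refl; prep; swap; trans)
open import Data.List.Relation.Binary.Permutation.Propositional.Properties using (shift; filter-↭; ↭-length; ∈-resp-↭; All-resp-↭; ++⁺ˡ; ++⁺ʳ; shifts)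
open import Data.List.Relation.Unary.Any as Any using (Any; here; there; any?)
open import Data.List.Relation.Unary.All as All using (All; []; _∷_)
import Data.List.Relation.Unary.All.Properties as All
open import Data.List.Relation.Unary.AllPairs as AllPairs using (AllPairs; []; _∷_)
open import Data.List.Relation.Unary.Linked as Linked using (Linked; []; [-]; _∷_)
open import Data.List.Relation.Unary.Unique.Propositional using (Unique)
import Data.List.Relation.Unary.Unique.Propositional.Properties as Unique
open import Data.Product using (∃; ∃₂; _×_; _,_; proj₁; proj₂)
open import Data.Product.Properties using (≡-dec)
open import Data.Sum using (_⊎_; inj₁; inj₂; [_,_]′)
open import Data.Empty using (⊥; ⊥-elim)
open import Function using (_∘_; id)
open import Relation.Nullary using (¬_; Dec; yes; no; contradiction)
open import Relation.Nullary.Decidable using (True; toWitness; ¬?; _×-dec_; _⊎-dec_; decidable-stable)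
open import Relation.Unary using (Decidable)
open import Relation.Binary using (DecidableEquality; tri<; tri≈; tri>)
import Relation.Binary as B
open import Relation.Binary.PropositionalEquality using (_≡_; _≢_; refl; sym; cong; cong₂; subst; subst₂; ≢-sym) renaming (trans to ≡-trans)

open +-*-Solver using (solve; _:+_; _:*_; _:=_; con)

-- The constants fit as 14 = 6 + 7 + 1 and 13 = 6 + 7. On conflict degree 14 Brooks' theorem alone
-- gives 14 colours; splitting first saves one more, and having no 7 pairwise conflicting edges is
-- exactly what the part of degree 6 asks for. The 14 is 2 + (2 + 3 + 2 + 3 + 2): the edges `uc` and
-- `vc`, and then the edges at `c`, `a₁`, `a₂`, `b₁`, `b₂`, each counted at the first of these ends.
-- Any two coincidences, such as an unexpected adjacency or an edge missing from `F`, push the count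
-- to 12, below the minimum degree. This is how the local structure is obtained. A single
-- coincidence is affordable, so one edge between the `aᵢ` and the `bⱼ` has to be tolerated in the
-- clique analysis. Conflicts are defined by adjacency in all of `G`, but only edges of `F` are
-- counted and only they are known to have this structure. An edge of `G` outside `F` may lie in
-- several triangles, hence the strict separation of `Adj` and `Has F`.

-- Lists without repetitions and their permutations

∈-split : {A : Set} {x : A} {ys : List A} → x ∈ ys → ∃ λ zs → ys ↭ x ∷ zs
∈-split x∈ys with ∈-∃++ x∈ys
... | as , bs , refl = as ++ bs , shift _ as bs

Unique-⊆⇒length≤ : {A : Set} {xs ys : List A} → Unique xs → xs ⊆ ys → length xs ≤ length ys
Unique-⊆⇒length≤ []         _     = z≤n
Unique-⊆⇒length≤ {xs = x ∷ xs} (x∉ ∷ xs!) xs⊆ with ∈-split (xs⊆ (here refl))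
... | zs , ys↭ = ≤-trans (s≤s (Unique-⊆⇒length≤ xs! xs⊆zs)) (≤-reflexive (sym (↭-length ys↭)))
  where
  xs⊆zs : xs ⊆ zs
  xs⊆zs y∈xs with ∈-resp-↭ ys↭ (xs⊆ (there y∈xs))
  ... | here y≡x   = contradiction (sym y≡x) (All.lookup x∉ y∈xs)
  ... | there y∈zs = y∈zs

Unique-resp-↭ : {A : Set} {xs ys : List A} → xs ↭ ys → Unique xs → Unique ys
Unique-resp-↭ refl          u               = u
Unique-resp-↭ (prep x p)    (x∉ ∷ u)        = All-resp-↭ p x∉ ∷ Unique-resp-↭ p u
Unique-resp-↭ (swap x y p)  ((x≢y ∷ x∉) ∷ y∉ ∷ u) =
  (≢-sym x≢y ∷ All-resp-↭ p y∉) ∷ All-resp-↭ p x∉ ∷ Unique-resp-↭ p u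
Unique-resp-↭ (trans p q)   u               = Unique-resp-↭ q (Unique-resp-↭ p u)

Unique-++⁻ˡ : {A : Set} (xs : List A) {ys : List A} → Unique (xs ++ ys) → Unique xs
Unique-++⁻ˡ []       _        = []
Unique-++⁻ˡ (x ∷ xs) (x∉ ∷ u) = All.++⁻ˡ xs x∉ ∷ Unique-++⁻ˡ xs u

Unique-++⁻ʳ : {A : Set} (xs : List A) {ys : List A} → Unique (xs ++ ys) → Unique ys
Unique-++⁻ʳ []       u       = u
Unique-++⁻ʳ (x ∷ xs) (_ ∷ u) = Unique-++⁻ʳ xs u

∉⇒All≢ : {A : Set} {x : A} {xs : List A} → x ∉ xs → All (x ≢_) xs
∉⇒All≢ x∉ = All.tabulate λ y∈ x≡y → x∉ (subst (_∈ _) (sym x≡y) y∈)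

pairwise⇒AllPairs : {A : Set} {R : A → A → Set} {xs : List A} → Unique xs →
                    (∀ {x y} → x ∈ xs → y ∈ xs → x ≢ y → R x y) → AllPairs R xs
pairwise⇒AllPairs []         _ = []
pairwise⇒AllPairs (x∉ ∷ xs!) r =
  All.tabulate (λ y∈ → r (here refl) (there y∈) (All.lookup x∉ y∈)) ∷ pairwise⇒AllPairs xs! λ p q → r (there p) (there q)

fresh : {k : ℕ} (xs : List (Fin k)) → length xs < k → ∃ (_∉ xs)
fresh {k} xs xs<k with Fin.any? (λ i → ¬? (any? (i Fin.≟_) xs))
... | yes free = free
... | no ¬free = contradiction
  (subst (_≤ length xs) (length-tabulate id) (Unique-⊆⇒length≤ (Unique.allFin⁺ k)
    λ {i} _ → decidable-stable (any? (i Fin.≟_) xs) λ i∉ → ¬free (i , i∉)))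
  (<⇒≱ xs<k)

-- Greedy colouring of a finite symmetric relation

module Colouring
  {V : Set} (_≟_ : DecidableEquality V)
  {R : V → V → Set} (R? : B.Decidable R)
  (R-sym : ∀ {x y} → R x y → R y x) (R-irrefl : ∀ {x} → ¬ R x x)
  where

  _∈?_ : (x : V) (xs : List V) → Dec (x ∈ xs)
  x ∈? xs = any? (x ≟_) xs

  without : V → List V → List V
  without x = filter (λ y → ¬? (x ≟ y))

  without-< : {x : V} {L : List V} → x ∈ L → length (without x L) < length L
  without-< {x} {L} x∈ = filter-notAll (λ y → ¬? (x ≟ y)) L (Any.map (λ x≡y x≢y → x≢y x≡y) x∈)

  without! : (x : V) {L : List V} → Unique L → Unique (without x L)
  without! x = Unique.filter⁺ (λ y → ¬? (x ≟ y))

  without-⊆ : {x : V} {L : List V} → without x L ⊆ L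
  without-⊆ {x} y∈ = proj₁ (∈-filter⁻ (λ y → ¬? (x ≟ y)) y∈)

  ⊆-without : {x : V} {L : List V} → L ⊆ x ∷ without x L
  ⊆-without {x} {L} {y} y∈ with x ≟ y
  ... | yes x≡y = here (sym x≡y)
  ... | no  x≢y = there (∈-filter⁺ (λ y → ¬? (x ≟ y)) y∈ x≢y)

  neighbours : V → List V → List V
  neighbours x = filter (R? x)

  degree : V → List V → ℕ
  degree x L = length (neighbours x L)

  ∈-neighbours⁺ : {x y : V} {L : List V} → y ∈ L → R x y → y ∈ neighbours x L
  ∈-neighbours⁺ {x} = ∈-filter⁺ (R? x)

  ∈-neighbours⁻ : {x y : V} {L : List V} → y ∈ neighbours x L → y ∈ L × R x y
  ∈-neighbours⁻ {x} = ∈-filter⁻ (R? x)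

  degree-mono : {x : V} {L M : List V} → Unique L → L ⊆ M → degree x L ≤ degree x M
  degree-mono {x} L! L⊆M = Unique-⊆⇒length≤ (Unique.filter⁺ (R? x) L!) λ y∈ →
    let y∈L , Rxy = ∈-neighbours⁻ y∈ in ∈-neighbours⁺ (L⊆M y∈L) Rxy

  degree-< : {x z : V} {L M : List V} → R x z → Unique (z ∷ L) → z ∷ L ⊆ M → degree x L < degree x M
  degree-< {x} {z} {L} {M} Rxz zL! zL⊆M =
    subst (_≤ degree x M) (cong length (filter-accept (R? x) {xs = L} Rxz)) (degree-mono zL! zL⊆M)

  Proper : {k : ℕ} → (V → Fin k) → List V → Set
  Proper c L = ∀ {x y} → x ∈ L → y ∈ L → R x y → c x ≢ c y

  Colourable : ℕ → List V → Set
  Colourable k L = ∃ λ (c : V → Fin k) → Proper c L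

  Proper-⊆ : {k : ℕ} {c : V → Fin k} {L M : List V} → L ⊆ M → Proper c M → Proper c L
  Proper-⊆ L⊆M proper x∈ y∈ = proper (L⊆M x∈) (L⊆M y∈)

  _[_↦_] : {k : ℕ} → (V → Fin k) → V → Fin k → V → Fin k
  (c [ x ↦ a ]) y with x ≟ y
  ... | yes _ = a
  ... | no  _ = c y

  ↦-new : {k : ℕ} (c : V → Fin k) (x : V) (a : Fin k) → (c [ x ↦ a ]) x ≡ a
  ↦-new c x a with x ≟ x
  ... | yes _  = refl
  ... | no x≢x = contradiction refl x≢x

  ↦-old : {k : ℕ} (c : V → Fin k) {x y : V} (a : Fin k) → x ≢ y → (c [ x ↦ a ]) y ≡ c y
  ↦-old c {x} {y} a x≢y with x ≟ y
  ... | yes x≡y = contradiction x≡y x≢y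
  ... | no  _   = refl

  recolour : {k : ℕ} {c : V → Fin k} {x : V} {a : Fin k} {L : List V} → Proper c L →
             (∀ {y} → y ∈ L → R x y → c y ≢ a) → Proper (c [ x ↦ a ]) (x ∷ L)
  recolour {x = x} proper free {y} {z} y∈ z∈ Ryz with x ≟ y | x ≟ z
  ... | yes refl | yes refl = contradiction Ryz R-irrefl
  ... | yes refl | no x≢z   = λ a≡ → free (old z∈) Ryz (sym a≡)
    where old : ∀ {L} → z ∈ x ∷ L → z ∈ L
          old (here z≡x) = contradiction (sym z≡x) x≢z
          old (there z∈) = z∈
  ... | no x≢y   | yes refl = free (old y∈) (R-sym Ryz)
    where old : ∀ {L} → y ∈ x ∷ L → y ∈ L
          old (here y≡x) = contradiction (sym y≡x) x≢y
          old (there y∈) = y∈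
  recolour {x = x} proper free {y} {z} (here y≡x)  z∈         Ryz | no x≢y | no x≢z = contradiction (sym y≡x) x≢y
  recolour {x = x} proper free {y} {z} (there _)   (here z≡x) Ryz | no x≢y | no x≢z = contradiction (sym z≡x) x≢z
  recolour {x = x} proper free {y} {z} (there y∈)  (there z∈) Ryz | no x≢y | no x≢z = proper y∈ z∈ Ryz

  -- Keeping the old colours matters: a vertex is coloured last because two of its neighbours were
  -- given the same colour long before, and they must still agree by then.
  Extension : {k : ℕ} → (V → Fin k) → List V → List V → Set
  Extension {k} c L M = ∃ λ (c′ : V → Fin k) → Proper c′ M × (∀ {y} → y ∈ L → c′ y ≡ c y)

  colour-vertex : {k : ℕ} {c : V → Fin k} {x : V} {L : List V} → Unique (x ∷ L) → Proper c L →
                  degree x L < k → Extension c L (x ∷ L)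
  colour-vertex {c = c} {x} {L} (x∉ ∷ _) proper d<k
    with fresh (map c (neighbours x L)) (subst (_< _) (sym (length-map c (neighbours x L))) d<k)
  ... | a , a∉ = c [ x ↦ a ]
    , recolour proper (λ y∈ Rxy cy≡a → a∉ (subst (_∈ _) cy≡a (∈-map⁺ c (∈-neighbours⁺ y∈ Rxy))))
    , λ y∈ → ↦-old c a (All.lookup x∉ y∈)

  -- Two neighbours of equal colour leave one colour more.
  colour-saving : {k : ℕ} {c : V → Fin k} {x y z : V} {L : List V} → Proper c L → degree x L ≤ k →
                  y ∈ L → z ∈ L → R x y → R x z → y ≢ z → c y ≡ c z → Colourable k (x ∷ L)
  colour-saving {k} {c} {x} {y} {z} {L} proper d≤k y∈ z∈ Rxy Rxz y≢z cy≡cz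
    with fresh (map c N) (subst (_< k) (sym (length-map c N)) (<-≤-trans (without-< (∈-neighbours⁺ y∈ Rxy)) d≤k))
    where N = without y (neighbours x L)
  ... | a , a∉ = c [ x ↦ a ] , recolour proper free
    where
    free : ∀ {w} → w ∈ L → R x w → c w ≢ a
    free w∈ Rxw cw≡a with ⊆-without {y} (∈-neighbours⁺ w∈ Rxw)
    ... | there w∈N = a∉ (subst (_∈ _) cw≡a (∈-map⁺ c w∈N))
    ... | here refl with ⊆-without {y} (∈-neighbours⁺ z∈ Rxz)
    ...   | here z≡y  = y≢z (sym z≡y)
    ...   | there z∈N = a∉ (subst (_∈ _) (≡-trans (sym cy≡cz) cw≡a) (∈-map⁺ c z∈N))

  degenerate-step : {k : ℕ} {x : V} {L : List V} → Unique L → degree x L < k →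
                    Colourable k (without x L) → Colourable k L
  degenerate-step {x = x} {L} L! d<k (c , proper)
    with colour-vertex (∉⇒All≢ (λ x∈ → proj₂ (∈-filter⁻ (λ y → ¬? (x ≟ y)) {xs = L} x∈) refl) ∷ without! x L!) proper
           (≤-<-trans (degree-mono (without! x L!) (without-⊆ {x} {L})) d<k)
  ... | c′ , proper′ , _ = c′ , Proper-⊆ ⊆-without proper′

  Linked-++⁻ˡ : (xs : List V) {ys : List V} → Linked R (xs ++ ys) → Linked R xs
  Linked-++⁻ˡ []           _       = []
  Linked-++⁻ˡ (x ∷ [])     _       = [-]
  Linked-++⁻ˡ (x ∷ y ∷ xs) (r ∷ l) = r ∷ Linked-++⁻ˡ (y ∷ xs) l

  Linked-++⁻ʳ : (xs : List V) {ys : List V} → Linked R (xs ++ ys) → Linked R ys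
  Linked-++⁻ʳ []       l = l
  Linked-++⁻ʳ (x ∷ xs) l = Linked-++⁻ʳ xs (Linked.tail l)

  Linked-∷ʳ : (xs : List V) {y z : V} → Linked R (xs ++ y ∷ []) → R y z → Linked R (xs ++ y ∷ z ∷ [])
  Linked-∷ʳ []            _       r = r ∷ [-]
  Linked-∷ʳ (x ∷ [])      (q ∷ _) r = q ∷ r ∷ [-]
  Linked-∷ʳ (x ∷ x′ ∷ xs) (q ∷ l) r = q ∷ Linked-∷ʳ (x′ ∷ xs) l r

  module Greedy {k : ℕ} {L : List V} (degree≤k : ∀ {x} → x ∈ L → degree x L ≤ k) where

    -- The neighbour `z` contributes to the degree of `x` but is not coloured yet, so at most
    -- `k - 1` colours are forbidden at `x`.
    colour-before : {c : V → Fin k} {x z : V} {M : List V} → R x z → Unique (z ∷ x ∷ M) → z ∷ x ∷ M ⊆ L →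
                    Proper c M → Extension c M (x ∷ M)
    colour-before Rxz ((z≢x ∷ z∉) ∷ xM!@(_ ∷ M!)) ⊆L proper = colour-vertex xM! proper
      (<-≤-trans (degree-< Rxz (z∉ ∷ M!) λ { (here p) → ⊆L (here p) ; (there q) → ⊆L (there (there q)) })
                 (degree≤k (⊆L (there (here refl)))))

    -- Colours the path P from its far end towards its uncoloured neighbour z.
    colour-towards : (P : List V) {z : V} {M : List V} {c : V → Fin k} → Linked R (z ∷ P) →
                     Unique (z ∷ P ++ M) → z ∷ P ++ M ⊆ L → Proper c M → Extension c M (P ++ M)
    colour-towards []      _       _                ⊆L proper = _ , proper , λ _ → refl
    colour-towards (p ∷ P) (r ∷ l) zpPM!@(_ ∷ pPM!) ⊆L proper
      with colour-towards P l pPM! (⊆L ∘ there) proper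
    ... | c′ , proper′ , agree′ with colour-before (R-sym r) zpPM! ⊆L proper′
    ...   | c″ , proper″ , agree″ = c″ , proper″ , λ y∈ → ≡-trans (agree″ (∈-++⁺ʳ P y∈)) (agree′ y∈)

    -- The mirror image of `colour-towards`: the order of colouring follows the list, and each
    -- vertex is safe because its successor, at the end `z`, is still uncoloured.
    colour-along : (P : List V) {z : V} {M : List V} {c : V → Fin k} → Linked R (P ++ z ∷ []) →
                   Unique (z ∷ P ++ M) → z ∷ P ++ M ⊆ L → Proper c M → Extension c M (P ++ M)
    colour-along []          _ _ _ proper = _ , proper , λ _ → refl
    colour-along (p ∷ P) {z} {M} l zpPM! ⊆L proper
      with colour-before (first P l) (next! P zpPM!) (⊆L ∘ next⊆ P) proper
      where
      next : List V → V
      next []      = z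
      next (q ∷ _) = q
      first : ∀ P → Linked R (p ∷ P ++ z ∷ []) → R p (next P)
      first []      (r ∷ _) = r
      first (q ∷ P) (r ∷ _) = r
      next! : ∀ P → Unique (z ∷ p ∷ P ++ M) → Unique (next P ∷ p ∷ M)
      next! []      u = u
      next! (q ∷ P) (_ ∷ (p≢q ∷ p∉) ∷ q∉ ∷ u) =
        (≢-sym p≢q ∷ All.++⁻ʳ P q∉) ∷ All.++⁻ʳ P p∉ ∷ Unique-++⁻ʳ P u
      next⊆ : ∀ P → next P ∷ p ∷ M ⊆ z ∷ p ∷ P ++ M
      next⊆ []      y∈                 = y∈
      next⊆ (q ∷ P) (here y≡q)         = there (there (here y≡q))
      next⊆ (q ∷ P) (there (here y≡p)) = there (here y≡p)
      next⊆ (q ∷ P) (there (there y∈)) = there (there (there (∈-++⁺ʳ P y∈)))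
    ... | c′ , proper′ , agree′ with colour-along P (Linked.tail l)
                                       (Unique-resp-↭ (prep z (↭-sym (shift p P M))) zpPM!)
                                       (⊆L ∘ ∈-resp-↭ (prep z (shift p P M))) proper′
    ...   | c″ , proper″ , agree″ = c″ , Proper-⊆ (∈-resp-↭ (↭-sym (shift p P M))) proper″
                                  , λ y∈ → ≡-trans (agree″ (there y∈)) (agree′ y∈)

  last-split : {P : V → Set} → Decidable P → {xs : List V} → Any P xs →
               ∃ λ as → ∃₂ λ y bs → xs ≡ as ++ y ∷ bs × P y × All (¬_ ∘ P) bs
  last-split P? {x ∷ xs} p with any? P? xs
  ... | yes q = let as , y , bs , eq , Py , none = last-split P? q in x ∷ as , y , bs , cong (x ∷_) eq , Py , none
  ... | no ¬q with p
  ...   | here Px = [] , x , xs , refl , Px , All.¬Any⇒All¬ xs ¬q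
  ...   | there q = contradiction q ¬q

  switch-split : {P : V → Set} → Decidable P → {x : V} {xs : List V} → ¬ P x → Any P xs →
                 ∃₂ λ as y → ∃₂ λ z bs → x ∷ xs ≡ as ++ y ∷ z ∷ bs × ¬ P y × P z
  switch-split P? {x} {x′ ∷ xs} ¬Px p with P? x′ | p
  ... | yes Px′ | _        = [] , x , x′ , xs , refl , ¬Px , Px′
  ... | no ¬Px′ | here Px′ = contradiction Px′ ¬Px′
  ... | no ¬Px′ | there q  =
    let as , y , z , bs , eq , ¬Py , Pz = switch-split P? ¬Px′ q in x ∷ as , y , z , bs , cong (x ∷_) eq , ¬Py , Pz

  Unique-++-disjoint : (xs : List V) {ys : List V} {x : V} → Unique (xs ++ ys) → x ∈ xs → x ∉ ys
  Unique-++-disjoint (_ ∷ xs) (x∉ ∷ _) (here refl) x∈ys = All.lookup x∉ (∈-++⁺ʳ xs x∈ys) refl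
  Unique-++-disjoint (_ ∷ xs) (_ ∷ u)  (there x∈)  x∈ys = Unique-++-disjoint xs u x∈ x∈ys

  last∈ : (as xs : List V) {x y : V} {bs : List V} → as ++ x ∷ bs ≡ xs ++ y ∷ [] → y ∈ x ∷ bs
  last∈ []       []           refl = here refl
  last∈ []       (_ ∷ xs)     refl = there (∈-insert xs)
  last∈ (a ∷ as) (_ ∷ xs)     eq   = last∈ as xs (proj₂ (∷-injective eq))
  last∈ (a ∷ [])     []       ()
  last∈ (a ∷ _ ∷ as) []       ()

  CliquesAtMost : ℕ → List V → Set
  CliquesAtMost k L = ∀ {Q} → AllPairs R Q → Q ⊆ L → length Q ≤ k

  front : List V → V → V
  front []      b = b
  front (t ∷ _) _ = t

  front-link : (T : List V) {w b : V} {B : List V} → R w (front T b) → Linked R (T ++ b ∷ B) → Linked R (w ∷ T ++ b ∷ B)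
  front-link []      r l = r ∷ l
  front-link (_ ∷ _) r l = r ∷ l

  -- The path grows at its front only, so the prescribed tail `b ∷ B` stays in place. A path that
  -- outgrew `fuel` would have more distinct vertices than `L`.
  maximal-path : {L : List V} {b : V} {B : List V} (fuel : ℕ) (T : List V) → length L < fuel + length (T ++ b ∷ B) →
                 Linked R (T ++ b ∷ B) → Unique (T ++ b ∷ B) → T ++ b ∷ B ⊆ L →
                 ∃ λ T′ → Linked R (T′ ++ b ∷ B) × Unique (T′ ++ b ∷ B) × T′ ++ b ∷ B ⊆ L ×
                   (∀ {w} → w ∈ L → R (front T′ b) w → w ∈ T′ ++ b ∷ B)
  maximal-path zero T L< _ P! P⊆L = contradiction (Unique-⊆⇒length≤ P! P⊆L) (<⇒≱ L<)
  maximal-path {L} {b} {B} (suc fuel) T L< l P! P⊆L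
    with any? (λ w → R? (front T b) w ×-dec ¬? (w ∈? (T ++ b ∷ B))) L
  ... | no ¬w = T , l , P! , P⊆L , λ {w} w∈ r →
    decidable-stable (w ∈? (T ++ b ∷ B)) λ w∉ → ¬w (lose w∈ (r , w∉))
  ... | yes p with find p
  ...   | w , w∈ , r , w∉ =
    maximal-path fuel (w ∷ T) (subst (length L <_) (sym (+-suc fuel _)) L<) (front-link T (R-sym r) l) (∉⇒All≢ w∉ ∷ P!)
      λ { (here refl) → w∈ ; (there q) → P⊆L q }

  -- Brooks' theorem

  -- The situation of a minimal counterexample: the two degree bounds make the relation `k`-regular
  -- on `L`, and every shorter sublist is colourable.
  module BrooksStep {k : ℕ} (3≤k : 3 ≤ k) {L : List V} (L! : Unique L)
    (degree≤k : ∀ {x} → x ∈ L → degree x L ≤ k) (k≤degree : ∀ {x} → x ∈ L → k ≤ degree x L)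
    (colour-smaller : ∀ {M} → Unique M → M ⊆ L → length M < length L → Colourable k M) where

    open Greedy degree≤k

    another-neighbour : {x : V} → x ∈ L → (y z : V) → ∃ λ w → w ∈ L × R x w × w ≢ y × w ≢ z
    another-neighbour {x} x∈ y z with any? (λ w → ¬? (w ∈? (y ∷ z ∷ []))) (neighbours x L)
    ... | yes p = let w , w∈ , w∉ = find p ; w∈L , r = ∈-neighbours⁻ w∈
                  in w , w∈L , r , w∉ ∘ here , w∉ ∘ there ∘ here
    ... | no ¬p = contradiction
      (≤-trans 3≤k (≤-trans (k≤degree x∈) (Unique-⊆⇒length≤ {ys = y ∷ z ∷ []} (Unique.filter⁺ (R? x) L!)
        λ {w} w∈ → decidable-stable (w ∈? (y ∷ z ∷ [])) λ w∉ → ¬p (lose w∈ w∉))))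
      λ { (s≤s (s≤s ())) }

    -- The non-adjacent `x` and `z` get one colour, so `y` can come last. The rest of the path must
    -- be coloured so that each vertex still has an uncoloured neighbour. A third neighbour `w` of
    -- `y` cuts `T` for this purpose: the piece `bs` between `w` and `z` is coloured back towards
    -- `w`, and then `as` and `w` are coloured forwards, `w` relying on the uncoloured `y`.
    spanning-path : (T : List V) {x y z : V} → Linked R (T ++ z ∷ y ∷ x ∷ []) → Unique (T ++ z ∷ y ∷ x ∷ []) →
                    T ++ z ∷ y ∷ x ∷ [] ⊆ L → L ⊆ T ++ z ∷ y ∷ x ∷ [] → R y x → R y z → ¬ R x z → Colourable k L
    spanning-path T {x} {y} {z} l P! P⊆L L⊆P Ryx Ryz ¬Rxz
      with another-neighbour (P⊆L (∈-++⁺ʳ T (there (here refl)))) x z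
    ... | w , w∈L , Ryw , w≢x , w≢z with ∈-++⁻ T (L⊆P w∈L)
    ...   | inj₂ (here w≡z)                 = contradiction w≡z w≢z
    ...   | inj₂ (there (here refl))        = contradiction Ryw R-irrefl
    ...   | inj₂ (there (there (here w≡x))) = contradiction w≡x w≢x
    ...   | inj₁ w∈T with ∈-∃++ w∈T
    ...     | as , bs , refl = colouring
      where
      a₀ : Fin k
      a₀ = fromℕ< (≤-trans (s≤s z≤n) 3≤k)
      M₀ = z ∷ x ∷ []
      M₁ = bs ++ M₀
      M₂ = (as ++ w ∷ []) ++ M₁
      perm : (as ++ w ∷ bs) ++ z ∷ y ∷ x ∷ [] ↭ y ∷ M₂
      perm = ↭-trans (shift-mid (as ++ w ∷ bs) z y (x ∷ []))
                     (prep y (↭-reflexive (reassoc as)))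
        where
        shift-mid : ∀ us p q vs → us ++ p ∷ q ∷ vs ↭ q ∷ us ++ p ∷ vs
        shift-mid us p q vs = ↭-trans (++⁺ˡ us (swap p q ↭-refl)) (shift q us (p ∷ vs))
        reassoc : ∀ as → (as ++ w ∷ bs) ++ M₀ ≡ (as ++ w ∷ []) ++ bs ++ M₀
        reassoc []       = refl
        reassoc (a ∷ as) = cong (a ∷_) (reassoc as)
      M! : Unique (y ∷ M₂)
      M! = Unique-resp-↭ perm P!
      M⊆L : y ∷ M₂ ⊆ L
      M⊆L = P⊆L ∘ ∈-resp-↭ (↭-sym perm)
      path : Linked R (as ++ w ∷ bs ++ z ∷ y ∷ x ∷ [])
      path = subst (Linked R) (++-assoc as (w ∷ bs) _) l
      wM₁! : Unique (w ∷ M₁)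
      wM₁! = Unique-++⁻ʳ as (subst Unique (++-assoc as (w ∷ []) M₁) (AllPairs.tail M!))
      wM₁⊆ : w ∷ M₁ ⊆ L
      wM₁⊆ v∈ = M⊆L (there (subst (_ ∈_) (sym (++-assoc as (w ∷ []) M₁)) (∈-++⁺ʳ as v∈)))
      M₀-proper : Proper {k} (λ _ → a₀) M₀
      M₀-proper (here refl)         (here refl)         r = contradiction r R-irrefl
      M₀-proper (here refl)         (there (here refl)) r = contradiction (R-sym r) ¬Rxz
      M₀-proper (there (here refl)) (here refl)         r = contradiction r ¬Rxz
      M₀-proper (there (here refl)) (there (here refl)) r = contradiction r R-irrefl
      colouring : Colourable k L
      colouring
        with colour-towards bs (Linked-++⁻ˡ (w ∷ bs) (Linked-++⁻ʳ as path)) wM₁! wM₁⊆ M₀-proper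
      ... | c₁ , proper₁ , agree₁
        with colour-along (as ++ w ∷ [])
               (subst (Linked R) (sym (++-assoc as (w ∷ []) (y ∷ [])))
                 (Linked-∷ʳ as (Linked-++⁻ˡ (as ++ w ∷ []) (subst (Linked R) (sym (++-assoc as (w ∷ []) _)) path)) (R-sym Ryw)))
               M! M⊆L proper₁
      ... | c₂ , proper₂ , agree₂
        with colour-saving proper₂ (≤-trans (degree-mono (AllPairs.tail M!) (M⊆L ∘ there)) (degree≤k (M⊆L (here refl))))
               (∈-++⁺ʳ (as ++ w ∷ []) (∈-++⁺ʳ bs (there (here refl)))) (∈-++⁺ʳ (as ++ w ∷ []) (∈-++⁺ʳ bs (here refl)))
               Ryx Ryz (λ { refl → z≢x refl })
               (≡-trans (at (there (here refl))) (sym (at (here refl))))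
        where
        at : ∀ {v} → v ∈ M₀ → c₂ v ≡ a₀
        at v∈ = ≡-trans (agree₂ (∈-++⁺ʳ bs v∈)) (agree₁ v∈)
        z≢x : z ≢ x
        z≢x refl = Unique-++-disjoint (z ∷ []) (Unique-++⁻ʳ (w ∷ bs) wM₁!) (here refl) (here refl)
      ... | c₃ , proper₃ = c₃ , Proper-⊆ (∈-resp-↭ perm ∘ L⊆P) proper₃

    outside : List V → List V
    outside C = filter (λ w → ¬? (w ∈? C)) L

    ∈-outside⁻ : {C : List V} {w : V} → w ∈ outside C → w ∈ L × w ∉ C
    ∈-outside⁻ {C} = ∈-filter⁻ (λ w → ¬? (w ∈? C))

    ⊆-outside : (C : List V) → L ⊆ C ++ outside C
    ⊆-outside C {w} w∈ with w ∈? C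
    ... | yes w∈C = ∈-++⁺ˡ w∈C
    ... | no  w∉C = ∈-++⁺ʳ C (∈-filter⁺ (λ w → ¬? (w ∈? C)) w∈ w∉C)

    outside! : (C : List V) → Unique (outside C)
    outside! C = Unique.filter⁺ (λ w → ¬? (w ∈? C)) L!

    colour-outside : {C : List V} {e : V} → e ∈ C → e ∈ L → Colourable k (outside C)
    colour-outside {C} e∈C e∈L = colour-smaller (outside! C) (proj₁ ∘ ∈-outside⁻ {C})
      (filter-notAll _ L (lose e∈L λ e∉C → e∉C e∈C))

    -- The witnesses `e` and `w` make both sides strictly shorter than `L`, so each has a colouring,
    -- and no relation between the sides can spoil their union.
    closed-part : {C : List V} {e w : V} → Unique C → C ⊆ L → e ∈ C → w ∈ outside C →
                  (∀ {x z} → x ∈ C → z ∈ outside C → ¬ R x z) → Colourable k L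
    closed-part {C} {e} {w} C! C⊆L e∈C w∈O closed
      with colour-smaller C! C⊆L (Unique-⊆⇒length≤ (∉⇒All≢ (proj₂ (∈-outside⁻ {C} w∈O)) ∷ C!)
             λ { (here refl) → proj₁ (∈-outside⁻ {C} w∈O) ; (there q) → C⊆L q })
         | colour-outside e∈C (C⊆L e∈C)
    ... | c₁ , proper₁ | c₂ , proper₂ = c , proper
      where
      c : V → Fin k
      c x with x ∈? C
      ... | yes _ = c₁ x
      ... | no  _ = c₂ x
      out : ∀ {x} → x ∈ L → x ∉ C → x ∈ outside C
      out = ∈-filter⁺ (λ w → ¬? (w ∈? C))
      proper : Proper c L
      proper {x} {y} x∈ y∈ r with x ∈? C | y ∈? C
      ... | yes x∈C | yes y∈C = proper₁ x∈C y∈C r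
      ... | yes x∈C | no  y∉C = contradiction r (closed x∈C (out y∈ y∉C))
      ... | no  x∉C | yes y∈C = contradiction (R-sym r) (closed y∈C (out x∈ x∉C))
      ... | no  x∉C | no  y∉C = proper₂ (out x∈ x∉C) (out y∈ y∉C) r

    -- y takes the colour of the outside neighbour z of x; going round the cycle from y, the vertex x comes last.
    open-cycle : (Q : List V) {y x v z : V} {S : List V} → let C = Q ++ y ∷ x ∷ S in
                 Unique C → C ⊆ L → Linked R C → Linked R (v ∷ Q) → v ∈ x ∷ S →
                 (∀ {w} → w ∈ outside C → ¬ R y w) → z ∈ outside C → R x z → Colourable k L
    open-cycle Q {y} {x} {v} {z} {S} C! C⊆L C-path vQ-path v∈ y-inner z∈O Rxz
      with colour-outside {Q ++ y ∷ x ∷ S} (∈-insert Q) (C⊆L (∈-insert Q))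
    ... | c₀ , proper₀ = colouring
      where
      C = Q ++ y ∷ x ∷ S
      O = outside C
      M₁ = Q ++ y ∷ O
      perm : C ++ O ↭ x ∷ S ++ M₁
      perm = ↭-trans (↭-reflexive (≡-trans (++-assoc Q (y ∷ x ∷ S) O) (sym (++-assoc Q (y ∷ []) (x ∷ S ++ O)))))
            (↭-trans (shifts (Q ++ y ∷ []) (x ∷ S) {O})
                     (↭-reflexive (cong (λ t → x ∷ S ++ t) (++-assoc Q (y ∷ []) O))))
      M! : Unique (x ∷ S ++ M₁)
      M! = Unique-resp-↭ perm (Unique.++⁺ C! (outside! C) λ (p , q) → proj₂ (∈-outside⁻ {C} q) p)
      M⊆L : x ∷ S ++ M₁ ⊆ L
      M⊆L w∈ with ∈-++⁻ C (∈-resp-↭ (↭-sym perm) w∈)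
      ... | inj₁ w∈C = C⊆L w∈C
      ... | inj₂ w∈O = proj₁ (∈-outside⁻ {C} w∈O)
      vM₁! : Unique (v ∷ M₁)
      vM₁! = ∉⇒All≢ (Unique-++-disjoint (x ∷ S) M! v∈) ∷ Unique-++⁻ʳ (x ∷ S) M!
      vM₁⊆ : v ∷ M₁ ⊆ L
      vM₁⊆ (here refl) = M⊆L (∈-++⁺ˡ v∈)
      vM₁⊆ (there w∈)  = M⊆L (∈-++⁺ʳ (x ∷ S) w∈)
      y∉O : y ∉ O
      y∉O y∈O = proj₂ (∈-outside⁻ {C} y∈O) (∈-insert Q)
      colouring : Colourable k L
      colouring
        with colour-towards Q vQ-path vM₁! vM₁⊆
               (recolour {x = y} {a = c₀ z} proper₀ λ w∈ r → contradiction r (y-inner w∈))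
      ... | c₁ , proper₁ , agree₁
        with colour-towards S (Linked-++⁻ʳ (Q ++ y ∷ []) (subst (Linked R) (sym (++-assoc Q (y ∷ []) (x ∷ S))) C-path)) M! M⊆L proper₁
      ... | c₂ , proper₂ , agree₂
        with colour-saving proper₂ (≤-trans (degree-mono (AllPairs.tail M!) (M⊆L ∘ there)) (degree≤k (M⊆L (here refl))))
               (∈-++⁺ʳ S (∈-insert Q)) (∈-++⁺ʳ S (∈-++⁺ʳ Q (there z∈O)))
               Rxy Rxz (λ { refl → y∉O z∈O })
               (≡-trans (at (here refl)) (≡-trans (↦-new c₀ y (c₀ z))
                 (sym (≡-trans (at (there z∈O)) (↦-old c₀ (c₀ z) λ { refl → y∉O z∈O })))))
        where
        at : ∀ {w} → w ∈ y ∷ O → c₂ w ≡ (c₀ [ y ↦ c₀ z ]) w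
        at w∈ = ≡-trans (agree₂ (∈-++⁺ʳ Q w∈)) (agree₁ w∈)
        Rxy : R x y
        Rxy = R-sym (Linked.head (Linked-++⁻ʳ Q C-path))
      ... | c₃ , proper₃ = c₃ , Proper-⊆ (∈-resp-↭ perm ∘ ⊆-outside C) proper₃

    -- The path `x`, `y`, `z` is prolonged beyond `z` until its new end `e` has all its neighbours
    -- on the path; this end yields a cycle, and what leaves the cycle decides the case.
    cherry : {x y z : V} → x ∈ L → y ∈ L → z ∈ L → R y x → R y z → x ≢ z → ¬ R x z → Colourable k L
    cherry {x} {y} {z} x∈ y∈ z∈ Ryx Ryz x≢z ¬Rxz
      with maximal-path {L} {z} {y ∷ x ∷ []} (suc (length L)) [] (s≤s (m≤m+n (length L) _)) (R-sym Ryz ∷ Ryx ∷ [-])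
             (((λ { refl → R-irrefl Ryz }) ∷ ≢-sym x≢z ∷ []) ∷ ((λ { refl → R-irrefl Ryx }) ∷ []) ∷ [] ∷ [])
             (λ { (here refl) → z∈ ; (there (here refl)) → y∈ ; (there (there (here refl))) → x∈ })
    ... | T , P-path , P! , P⊆L , front-inner = close (T ++ z ∷ y ∷ x ∷ []) (front T z) (shape T) P-path P! P⊆L front-inner
          (λ P⊇L → spanning-path T P-path P! P⊆L P⊇L Ryx Ryz ¬Rxz)
      where
      shape : ∀ T → ∃ λ P′ → T ++ z ∷ y ∷ x ∷ [] ≡ front T z ∷ P′
      shape []      = _ , refl
      shape (t ∷ T) = _ , refl
      close : ∀ P e → (∃ λ P′ → P ≡ e ∷ P′) → Linked R P → Unique P → P ⊆ L → (∀ {w} → w ∈ L → R e w → w ∈ P) →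
              (L ⊆ P → Colourable k L) → Colourable k L
      close P e (P′ , refl) P-path P! P⊆L e-inner spanning with another-neighbour (P⊆L (here refl)) e e
      -- The neighbour `v` of `e` farthest along the path closes the cycle `C`. All neighbours of
      -- `e` then lie on `C`, so `e` has no neighbour outside.
      ... | u , u∈L , Reu , _ with last-split (R? e) (lose (e-inner u∈L Reu) Reu)
      ... | []     , v , bs , refl , Rev , _ = contradiction Rev R-irrefl
      ... | a ∷ as , v , bs , refl , Rev , none = cycle
        where
        C = e ∷ as ++ v ∷ []
        P≡ : P ≡ C ++ bs
        P≡ = cong (e ∷_) (sym (++-assoc as (v ∷ []) bs))
        O = outside C
        C-path : Linked R C
        C-path = Linked-++⁻ˡ C (subst (Linked R) P≡ P-path)
        C! : Unique C
        C! = Unique-++⁻ˡ C (subst Unique P≡ P!)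
        C⊆P : C ⊆ P
        C⊆P {w} w∈ = subst (w ∈_) (sym P≡) (∈-++⁺ˡ w∈)
        C⊆L : C ⊆ L
        C⊆L w∈ = P⊆L (C⊆P w∈)
        e-closed : ∀ {w} → w ∈ O → ¬ R e w
        e-closed {w} w∈O Rew with ∈-outside⁻ {C} w∈O
        ... | w∈L , w∉C with ∈-++⁻ C (subst (w ∈_) P≡ (e-inner w∈L Rew))
        ...   | inj₁ w∈C  = w∉C w∈C
        ...   | inj₂ w∈bs = All.lookup none w∈bs Rew
        exits? : Decidable (λ x → Any (R x) O)
        exits? x = any? (R? x) O
        cycle : Colourable k L
        cycle with any? exits? (as ++ v ∷ [])
        ... | yes p with switch-split exits? {e} (λ q → let w , w∈ , r = find q in e-closed w∈ r) p
        -- Since `e` has no neighbour outside and some later vertex has one, somewhere a vertex `y`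
        -- without is followed directly by a vertex `x` with one.
        ...   | Q , y , x , S , C≡ , ¬exit-y , exit-x with find exit-x
        ...     | z , z∈O , Rxz =
          open-cycle Q (subst Unique C≡ C!) (C⊆L ∘ subst (_ ∈_) (sym C≡)) (subst (Linked R) C≡ C-path) (wrap Q C≡)
            (last∈ (Q ++ y ∷ []) (e ∷ as) (≡-trans (++-assoc Q (y ∷ []) (x ∷ S)) (sym C≡)))
            (λ w∈ r → ¬exit-y (lose (subst (λ C → _ ∈ outside C) (sym C≡) w∈) r))
            (subst (λ C → z ∈ outside C) C≡ z∈O) Rxz
          where
          wrap : ∀ Q → C ≡ Q ++ y ∷ x ∷ S → Linked R (v ∷ Q)
          wrap []      _  = [-]
          wrap (q ∷ Q) C≡ with ∷-injective C≡
          ... | refl , _ = R-sym Rev ∷ Linked-++⁻ˡ (q ∷ Q) (subst (Linked R) C≡ C-path)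
        cycle | no ¬p with O in O≡
        -- Nothing lies outside the cycle, so the path containing it covers `L`; here the
        -- non-adjacency of `x` and `z` is used.
        ... | []    = spanning λ w∈ → C⊆P ([ id , (λ w∈O → contradiction (subst (_ ∈_) O≡ w∈O) λ ()) ]′
                                            (∈-++⁻ C (⊆-outside C w∈)))
        ... | o ∷ _ = closed-part C! C⊆L (here refl) (subst (o ∈_) (sym O≡) (here refl)) λ where
          (here refl) w∈O r → e-closed w∈O r
          (there x∈)  w∈O r → ¬p (lose x∈ (lose (subst (_ ∈_) O≡ w∈O) r))

  brooks : {k : ℕ} → 3 ≤ k → (L : List V) → Acc _<_ (length L) → Unique L → (∀ {x} → x ∈ L → degree x L ≤ k) →
           CliquesAtMost k L → Colourable k L
  brooks 3≤k []        _             _  _        _       = (λ _ → fromℕ< (≤-trans (s≤s z≤n) 3≤k)) , λ ()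
  brooks {k} 3≤k L@(v ∷ _) (acc smaller) L! degree≤k cliques = step
    where
    colour-smaller : ∀ {M} → Unique M → M ⊆ L → length M < length L → Colourable k M
    colour-smaller {M} M! M⊆L M< = brooks 3≤k M (smaller M<) M!
      (λ x∈ → ≤-trans (degree-mono M! M⊆L) (degree≤k (M⊆L x∈))) λ Q-clique Q⊆M → cliques Q-clique (M⊆L ∘ Q⊆M)
    Cherry : V → V → V → Set
    Cherry y x z = R y x × R y z × x ≢ z × ¬ R x z
    cherry? : ∀ y x z → Dec (Cherry y x z)
    cherry? y x z = R? y x ×-dec R? y z ×-dec ¬? (x ≟ z) ×-dec ¬? (R? x z)
    step : Colourable k L
    step with any? (λ x → degree x L <? k) L
    ... | yes p with find p
    ...   | x , x∈ , d<k = degenerate-step L! d<k (colour-smaller (without! x L!) (without-⊆ {x}) (without-< x∈))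
    step | no ¬low with any? (λ y → any? (λ x → any? (cherry? y x) L) L) L
    ... | yes p with find p
    ...   | y , y∈ , q with find q
    ...     | x , x∈ , r with find r
    ...       | z , z∈ , Ryx , Ryz , x≢z , ¬Rxz =
      BrooksStep.cherry 3≤k L! degree≤k (λ x∈ → ≮⇒≥ λ d<k → ¬low (lose x∈ d<k)) colour-smaller x∈ y∈ z∈ Ryx Ryz x≢z ¬Rxz
    -- Without a cherry the neighbours of `v` are pairwise related, and `v` together with its at
    -- least `k` neighbours is a clique that is too large.
    step | no ¬low | no ¬cherry = contradiction (cliques
        (All.tabulate (proj₂ ∘ ∈-neighbours⁻ {v}) ∷ pairwise⇒AllPairs (Unique.filter⁺ (R? v) L!) λ {x} {z} x∈ z∈ x≢z →
          let x∈L , Rvx = ∈-neighbours⁻ {v} x∈ ; z∈L , Rvz = ∈-neighbours⁻ {v} z∈ in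
          decidable-stable (R? x z) λ ¬Rxz → ¬cherry (lose (here refl) (lose x∈L (lose z∈L (Rvx , Rvz , x≢z , ¬Rxz)))))
        λ { (here refl) → here refl ; (there q) → proj₁ (∈-neighbours⁻ {v} q) })
      (<⇒≱ (s≤s (≮⇒≥ λ d<k → ¬low (here d<k))))

  -- Lovász's partition into parts of bounded degree

  -- Every vertex is compared with the later ones only, so this is the number of related pairs
  -- inside the list, each counted once.
  inner : List V → ℕ
  inner []      = 0
  inner (x ∷ L) = degree x L + inner L

  degree-∷ : (x y : V) (L : List V) → degree x (y ∷ L) ≡ degree x (y ∷ []) + degree x L
  degree-∷ x y L = ≡-trans (cong length (filter-++ (R? x) (y ∷ []) L)) (length-++ (neighbours x (y ∷ [])))

  degree-++ : (x : V) (L : List V) {M : List V} → degree x (L ++ M) ≡ degree x L + degree x M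
  degree-++ x L = ≡-trans (cong length (filter-++ (R? x) L _)) (length-++ (neighbours x L))

  degree-↭ : {x : V} {L M : List V} → L ↭ M → degree x L ≡ degree x M
  degree-↭ {x} L↭M = ↭-length (filter-↭ (R? x) L↭M)

  degree-∷-self : (x : V) (L : List V) → degree x (x ∷ L) ≡ degree x L
  degree-∷-self x L = cong length (filter-reject (R? x) R-irrefl)

  degree-swap : (x y : V) → degree x (y ∷ []) ≡ degree y (x ∷ [])
  degree-swap x y with R? x y | R? y x
  ... | yes _ | yes _ = refl
  ... | no _  | no _  = refl
  ... | yes r | no ¬r = contradiction (R-sym r) ¬r
  ... | no ¬r | yes r = contradiction (R-sym r) ¬r

  inner-↭ : {L M : List V} → L ↭ M → inner L ≡ inner M
  inner-↭ refl                    = refl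
  inner-↭ (prep x p)              = cong₂ _+_ (degree-↭ p) (inner-↭ p)
  inner-↭ (swap {L} {M} x y p)
    rewrite degree-∷ x y L | degree-∷ y x M | degree-swap x y | degree-↭ {x} p | degree-↭ {y} p | inner-↭ p =
    solve 4 (λ s a b c → (s :+ a) :+ (b :+ c) := (s :+ b) :+ (a :+ c)) refl (degree y (x ∷ [])) (degree x M) (degree y M) (inner M)
  inner-↭ (trans p q)             = ≡-trans (inner-↭ p) (inner-↭ q)

  -- Each vertex weighs the degree bound of the opposite part. For `p = q` the weights add up to a
  -- constant, and only the number of pairs inside the parts matters.
  potential : ℕ → ℕ → List V → List V → ℕ
  potential p q L M = (inner L + q * length L) + (inner M + p * length M)

  potential-comm : (p q : ℕ) (L M : List V) → potential p q L M ≡ potential q p M L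
  potential-comm p q L M = +-comm (inner L + q * length L) _

  -- Having more than `p` neighbours in `L`, the vertex `x` has at most `q` in `M`. The move loses
  -- at least `p + 1` pairs and the weight `q`; it gains at most `q` pairs and the weight `p`.
  potential-decreases : {p q : ℕ} {x : V} {K L M : List V} → L ↭ x ∷ K → p < degree x L →
                        degree x L + degree x M ≤ suc (p + q) → potential p q K (x ∷ M) < potential p q L M
  potential-decreases {p} {q} {x} {K} {L} {M} L↭ p<d d≤
    rewrite inner-↭ L↭ | ↭-length L↭ | degree-↭ {x} L↭ | degree-∷-self x K =
    subst₂ _<_
      (solve 7 (λ d p q i l j m → (d :+ p) :+ ((i :+ q :* l) :+ (j :+ p :* m)) := (i :+ q :* l) :+ ((d :+ j) :+ p :* (con 1 :+ m)))
        refl (degree x M) p q (inner K) (length K) (inner M) (length M))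
      (solve 7 (λ d p q i l j m → (q :+ d) :+ ((i :+ q :* l) :+ (j :+ p :* m)) := ((d :+ i) :+ q :* (con 1 :+ l)) :+ (j :+ p :* m))
        refl (degree x K) p q (inner K) (length K) (inner M) (length M))
      (+-monoˡ-< _ (+-mono-≤-< dM≤q p<d))
    where
    dM≤q : degree x M ≤ q
    dM≤q = +-cancelˡ-≤ (suc p) _ _ (≤-trans (+-monoˡ-≤ (degree x M) p<d) d≤)

  lovász : {p q : ℕ} {F : List V} → (∀ {x} → x ∈ F → degree x F ≤ suc (p + q)) →
           (L M : List V) → L ++ M ↭ F → Acc _<_ (potential p q L M) →
           ∃₂ λ L M → L ++ M ↭ F × (∀ {x} → x ∈ L → degree x L ≤ p) × (∀ {x} → x ∈ M → degree x M ≤ q)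
  lovász {p} {q} {F} degree≤ L M LM↭F (acc smaller) = step
    where
    degree≤′ : ∀ {x} → x ∈ L ++ M → degree x L + degree x M ≤ suc (p + q)
    degree≤′ {x} x∈ = subst (_≤ suc (p + q)) (≡-trans (sym (degree-↭ LM↭F)) (degree-++ x L)) (degree≤ (∈-resp-↭ LM↭F x∈))
    step : _
    step with any? (λ x → p <? degree x L) L
    ... | yes above with find above
    ...   | x , x∈L , p<d with ∈-split x∈L
    ...     | K , L↭ = lovász degree≤ K (x ∷ M)
      (↭-trans (shift x K M) (↭-trans (++⁺ʳ M (↭-sym L↭)) LM↭F))
      (smaller (potential-decreases {M = M} L↭ p<d (degree≤′ (∈-++⁺ˡ x∈L))))
    step | no ¬aboveᴸ with any? (λ x → q <? degree x M) M
    ... | yes above with find above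
    ...   | x , x∈M , q<d with ∈-split x∈M
    ...     | K , M↭ = lovász degree≤ (x ∷ L) K
      (↭-trans (↭-sym (shift x L K)) (↭-trans (++⁺ˡ L (↭-sym M↭)) LM↭F))
      (smaller (subst₂ _<_ (potential-comm q p K (x ∷ L)) (potential-comm q p M L)
        (potential-decreases {M = L} M↭ q<d (subst₂ _≤_ (+-comm (degree x L) _) (cong suc (+-comm p q)) (degree≤′ (∈-++⁺ʳ L x∈M))))))
    step | no ¬aboveᴸ | no ¬aboveᴹ = L , M , LM↭F
      , (λ x∈ → ≮⇒≥ λ p<d → ¬aboveᴸ (lose x∈ p<d)) , (λ x∈ → ≮⇒≥ λ q<d → ¬aboveᴹ (lose x∈ q<d))

  ++-colourable : {p q : ℕ} {L M : List V} → Colourable p L → Colourable q M → Colourable (p + q) (L ++ M)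
  ++-colourable {p} {q} {L} {M} (c , c-proper) (d , d-proper) = cd , proper
    where
    cd : V → Fin (p + q)
    cd x with x ∈? L
    ... | yes _ = c x ↑ˡ q
    ... | no  _ = p ↑ʳ d x
    right : ∀ {x} → x ∉ L → x ∈ L ++ M → x ∈ M
    right x∉ x∈ = [ (λ x∈L → contradiction x∈L x∉) , id ]′ (∈-++⁻ L x∈)
    apart : ∀ {i j} → i ↑ˡ q ≢ p ↑ʳ j
    apart {i} {j} eq with ≡-trans (sym (Fin.splitAt-↑ˡ p i q)) (≡-trans (cong (splitAt p) eq) (Fin.splitAt-↑ʳ p q j))
    ... | ()
    proper : Proper cd (L ++ M)
    proper {x} {y} x∈ y∈ r with x ∈? L | y ∈? L
    ... | yes x∈L | yes y∈L = c-proper x∈L y∈L r ∘ Fin.↑ˡ-injective q _ _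
    ... | yes x∈L | no  y∉L = apart
    ... | no  x∉L | yes y∈L = apart ∘ sym
    ... | no  x∉L | no  y∉L = d-proper (right x∉L x∈) (right y∉L y∈) r ∘ Fin.↑ʳ-injective p _ _

  -- This is one colour better than Brooks on all of `F`. The clique bound `p` serves both parts
  -- because `p ≤ q`.
  catlin : {p q : ℕ} {F : List V} → 3 ≤ p → p ≤ q → Unique F → (∀ {x} → x ∈ F → degree x F ≤ suc (p + q)) →
           CliquesAtMost p F → Colourable (p + q) F
  catlin {p} {q} {F} 3≤p p≤q F! degree≤ cliques
    with lovász degree≤ F [] (↭-reflexive (++-identityʳ F)) (<-wellFounded _)
  ... | L , M , LM↭F , degreeᴸ , degreeᴹ =
    let LM! = Unique-resp-↭ (↭-sym LM↭F) F!
        c , proper = ++-colourable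
          (brooks 3≤p L (<-wellFounded _) (Unique-++⁻ˡ L LM!) degreeᴸ
            λ Q-clique Q⊆L → cliques Q-clique (∈-resp-↭ LM↭F ∘ ∈-++⁺ˡ ∘ Q⊆L))
          (brooks (≤-trans 3≤p p≤q) M (<-wellFounded _) (Unique-++⁻ʳ L LM!) degreeᴹ
            λ Q-clique Q⊆M → ≤-trans (cliques Q-clique (∈-resp-↭ LM↭F ∘ ∈-++⁺ʳ L ∘ Q⊆M)) p≤q)
    in c , Proper-⊆ (∈-resp-↭ (↭-sym LM↭F)) proper

pattern #0 = here refl
pattern #1 = there #0
pattern #2 = there #1
pattern #3 = there #2
pattern #4 = there #3
pattern #5 = there #4

-- The conflict relation on pairs of vertices

module ConflictGraph {n : ℕ} (G : Graph n) where

  open Graph G using (Adj; adj?; Conflict) renaming (sym to adj-sym; irrefl to adj-irrefl)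

  Vertex Edge : Set
  Vertex = Fin n
  Edge   = Vertex × Vertex

  _≟ᵛ_ : DecidableEquality Vertex
  _≟ᵛ_ = Fin._≟_

  _≟ᵉ_ : DecidableEquality Edge
  _≟ᵉ_ = ≡-dec _≟ᵛ_ _≟ᵛ_

  Conf : Edge → Edge → Set
  Conf (a , b) (c , d) = Conflict a b c d

  conf? : B.Decidable Conf
  conf? (a , b) (c , d) =
    (¬? (a ≟ᵛ c) ×-dec ¬? (a ≟ᵛ d) ×-dec ¬? (b ≟ᵛ c) ×-dec ¬? (b ≟ᵛ d) ×-dec
      (adj? a c ⊎-dec adj? a d ⊎-dec adj? b c ⊎-dec adj? b d))
    ⊎-dec
    ((a ≟ᵛ c ×-dec ¬? (b ≟ᵛ d) ×-dec adj? b d) ⊎-dec (a ≟ᵛ d ×-dec ¬? (b ≟ᵛ c) ×-dec adj? b c) ⊎-dec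
     (b ≟ᵛ c ×-dec ¬? (a ≟ᵛ d) ×-dec adj? a d) ⊎-dec (b ≟ᵛ d ×-dec ¬? (a ≟ᵛ c) ×-dec adj? a c))

  conf-sym : ∀ {e f} → Conf e f → Conf f e
  conf-sym (inj₁ (p , q , r , s , near)) = inj₁ (≢-sym p , ≢-sym r , ≢-sym q , ≢-sym s , flip near)
    where
    flip : _ → _
    flip (inj₁ x)               = inj₁ (adj-sym x)
    flip (inj₂ (inj₁ x))        = inj₂ (inj₂ (inj₁ (adj-sym x)))
    flip (inj₂ (inj₂ (inj₁ x))) = inj₂ (inj₁ (adj-sym x))
    flip (inj₂ (inj₂ (inj₂ x))) = inj₂ (inj₂ (inj₂ (adj-sym x)))
  conf-sym (inj₂ (inj₁ (p , q , r)))               = inj₂ (inj₁ (sym p , ≢-sym q , adj-sym r))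
  conf-sym (inj₂ (inj₂ (inj₁ (p , q , r))))        = inj₂ (inj₂ (inj₂ (inj₁ (sym p , ≢-sym q , adj-sym r))))
  conf-sym (inj₂ (inj₂ (inj₂ (inj₁ (p , q , r))))) = inj₂ (inj₂ (inj₁ (sym p , ≢-sym q , adj-sym r)))
  conf-sym (inj₂ (inj₂ (inj₂ (inj₂ (p , q , r))))) = inj₂ (inj₂ (inj₂ (inj₂ (sym p , ≢-sym q , adj-sym r))))

  conf-swapʳ : ∀ {e c d} → Conf e (c , d) → Conf e (d , c)
  conf-swapʳ (inj₁ (p , q , r , s , near)) = inj₁ (q , p , s , r , flip near)
    where
    flip : _ → _
    flip (inj₁ x)               = inj₂ (inj₁ x)
    flip (inj₂ (inj₁ x))        = inj₁ x
    flip (inj₂ (inj₂ (inj₁ x))) = inj₂ (inj₂ (inj₂ x))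
    flip (inj₂ (inj₂ (inj₂ x))) = inj₂ (inj₂ (inj₁ x))
  conf-swapʳ (inj₂ (inj₁ t))               = inj₂ (inj₂ (inj₁ t))
  conf-swapʳ (inj₂ (inj₂ (inj₁ t)))        = inj₂ (inj₁ t)
  conf-swapʳ (inj₂ (inj₂ (inj₂ (inj₁ t)))) = inj₂ (inj₂ (inj₂ (inj₂ t)))
  conf-swapʳ (inj₂ (inj₂ (inj₂ (inj₂ t)))) = inj₂ (inj₂ (inj₂ (inj₁ t)))

  conf-swapˡ : ∀ {a b f} → Conf (a , b) f → Conf (b , a) f
  conf-swapˡ {a} {b} {f} k = conf-sym {f} {b , a} (conf-swapʳ {f} (conf-sym {a , b} {f} k))

  conf-irrefl : ∀ {e} → ¬ Conf e e
  conf-irrefl (inj₁ (p , _))                           = p refl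
  conf-irrefl (inj₂ (inj₁ (_ , q , _)))                = q refl
  conf-irrefl (inj₂ (inj₂ (inj₁ (p , q , _))))         = q (sym p)
  conf-irrefl (inj₂ (inj₂ (inj₂ (inj₁ (p , q , _)))))  = q (sym p)
  conf-irrefl (inj₂ (inj₂ (inj₂ (inj₂ (_ , q , _)))))  = q refl

  open Colouring _≟ᵉ_ {Conf} conf? (λ {e} {f} → conf-sym {e} {f}) (λ {e} → conf-irrefl {e}) public

  adj⇒≢ : ∀ {x y} → Adj x y → x ≢ y
  adj⇒≢ xy refl = adj-irrefl xy

  separated : ∀ {z x y} → Adj z x → ¬ Adj z y → x ≢ y
  separated zx ¬zy refl = ¬zy zx

  -- Unordered membership: lists of edges store one orientation, while the counting arrives at an
  -- edge from either end.
  Has : List Edge → Vertex → Vertex → Set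
  Has L x y = (x , y) ∈ L ⊎ (y , x) ∈ L

  has-sym : ∀ {L x y} → Has L x y → Has L y x
  has-sym = [ inj₂ , inj₁ ]′

  has? : ∀ L x y → Dec (Has L x y)
  has? L x y = ((x , y) ∈? L) ⊎-dec ((y , x) ∈? L)

  has-++ˡ : ∀ {K L x y} → Has K x y → Has (K ++ L) x y
  has-++ˡ = [ inj₁ ∘ ∈-++⁺ˡ , inj₂ ∘ ∈-++⁺ˡ ]′

  has-++ʳ : ∀ K {L x y} → Has L x y → Has (K ++ L) x y
  has-++ʳ K = [ inj₁ ∘ ∈-++⁺ʳ K , inj₂ ∘ ∈-++⁺ʳ K ]′

  Oriented : List Edge → Set
  Oriented L = ∀ {x y} → (x , y) ∈ L → x <ᶠ y × Adj x y

  orient : Edge → Edge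
  orient (x , y) with x Fin.<? y
  ... | yes _ = x , y
  ... | no  _ = y , x

  orient-< : ∀ {x y} → x <ᶠ y → orient (x , y) ≡ (x , y)
  orient-< {x} {y} x<y with x Fin.<? y
  ... | yes _  = refl
  ... | no x≮y = contradiction x<y x≮y

  orient-> : ∀ {x y} → x <ᶠ y → orient (y , x) ≡ (x , y)
  orient-> {x} {y} x<y with y Fin.<? x
  ... | yes y<x = contradiction y<x (Fin.<-asym {x = x} {y} x<y)
  ... | no _    = refl

  -- Applying `orient` to every entry of `K` gives a list of the same length that contains `L`,
  -- whichever way the entries of `K` point.
  cover-length : ∀ {L K} → Unique L → Oriented L → (∀ {x y} → (x , y) ∈ L → Has K x y) → length L ≤ length K
  cover-length {L} {K} L! oriented cover = subst (length L ≤_) (length-map orient K) (Unique-⊆⇒length≤ L! L⊆)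
    where
    L⊆ : L ⊆ map orient K
    L⊆ {x , y} xy∈ with cover xy∈
    ... | inj₁ xy∈K = subst (_∈ _) (orient-< (proj₁ (oriented xy∈))) (∈-map⁺ orient xy∈K)
    ... | inj₂ yx∈K = subst (_∈ _) (orient-> (proj₁ (oriented xy∈))) (∈-map⁺ orient yx∈K)

  -- A normal form for edges `wz` in conflict with `uv`, seen from an end `w` off `uv`. In the first
  -- alternative `z` is off `uv` too (distance two); in the second `w` is a common neighbour and the
  -- edge runs back to `u` or `v` (triangle). The two are counted separately.
  Touches : Vertex → Vertex → Vertex → Vertex → Set
  Touches u v w z = w ≢ u × w ≢ v ×
    (((Adj u w ⊎ Adj v w) × z ≢ u × z ≢ v) ⊎ ((Adj u w × Adj v w) × (z ≡ u ⊎ z ≡ v)))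

  conflict⇒touches : ∀ {u v x y} → Adj x y → Conflict u v x y → Touches u v x y ⊎ Touches u v y x
  conflict⇒touches xy (inj₁ (u≢x , u≢y , v≢x , v≢y , near)) = go near
    where
    go : _ → _
    go (inj₁ ux)               = inj₁ (≢-sym u≢x , ≢-sym v≢x , inj₁ (inj₁ ux , ≢-sym u≢y , ≢-sym v≢y))
    go (inj₂ (inj₁ uy))        = inj₂ (≢-sym u≢y , ≢-sym v≢y , inj₁ (inj₁ uy , ≢-sym u≢x , ≢-sym v≢x))
    go (inj₂ (inj₂ (inj₁ vx))) = inj₁ (≢-sym u≢x , ≢-sym v≢x , inj₁ (inj₂ vx , ≢-sym u≢y , ≢-sym v≢y))
    go (inj₂ (inj₂ (inj₂ vy))) = inj₂ (≢-sym u≢y , ≢-sym v≢y , inj₁ (inj₂ vy , ≢-sym u≢x , ≢-sym v≢x))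
  conflict⇒touches xy (inj₂ (inj₁ (refl , v≢y , vy)))               =
    inj₂ (≢-sym (adj⇒≢ xy) , ≢-sym v≢y , inj₂ ((xy , vy) , inj₁ refl))
  conflict⇒touches xy (inj₂ (inj₂ (inj₁ (refl , v≢x , vx))))        =
    inj₁ (adj⇒≢ xy , ≢-sym v≢x , inj₂ ((adj-sym xy , vx) , inj₁ refl))
  conflict⇒touches xy (inj₂ (inj₂ (inj₂ (inj₁ (refl , u≢y , uy))))) =
    inj₂ (≢-sym u≢y , ≢-sym (adj⇒≢ xy) , inj₂ ((uy , xy) , inj₂ refl))
  conflict⇒touches xy (inj₂ (inj₂ (inj₂ (inj₂ (refl , u≢x , ux))))) =
    inj₁ (≢-sym u≢x , adj⇒≢ xy , inj₂ ((ux , adj-sym xy) , inj₂ refl))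

  nbrs : Vertex → List Vertex
  nbrs w = filter (adj? w) (allFin n)

  nbrs! : ∀ w → Unique (nbrs w)
  nbrs! w = Unique.filter⁺ (adj? w) (Unique.allFin⁺ n)

  ∈-nbrs : ∀ {w x} → Adj w x → x ∈ nbrs w
  ∈-nbrs {w} {x} wx = ∈-filter⁺ (adj? w) (∈-allFin x) wx

  _∈ᵛ?_ : (x : Vertex) (xs : List Vertex) → Dec (x ∈ xs)
  x ∈ᵛ? xs = any? (x ≟ᵛ_) xs

  Aside : Vertex → Vertex → Vertex → Set
  Aside u v a = Adj u a × ¬ Adj v a × a ≢ v

  aside? : ∀ u v a → Dec (Aside u v a)
  aside? u v a = adj? u a ×-dec ¬? (adj? v a) ×-dec ¬? (a ≟ᵛ v)

  -- Counting edges at a sequence of vertices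

  record Slots (S : Vertex → Vertex → Set) (X : List Vertex) (w : Vertex) (k : ℕ) : Set where
    constructor within
    field
      Z       : List Vertex
      |Z|≤k   : length Z ≤ k
      Z-cover : ∀ {z} → Adj w z → z ∉ X → S w z → z ∈ Z

  -- Counts every edge of S meeting ws and avoiding X once, at the first of its ends in ws.
  data Incidences (S : Vertex → Vertex → Set) : List Vertex → List Vertex → ℕ → Set where
    []  : ∀ {X} → Incidences S X [] 0
    _∷_ : ∀ {X w ws k m} → Slots S X w k → Incidences S (w ∷ X) ws m → Incidences S X (w ∷ ws) (k + m)

  module _ {S : Vertex → Vertex → Set} where

    slots-⊆ : ∀ {X X′ w k} → X ⊆ X′ → Slots S X w k → Slots S X′ w k
    slots-⊆ X⊆ (within Z Z≤ cover) = within Z Z≤ λ wz z∉ → cover wz (z∉ ∘ X⊆)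

    incidences-⊆ : ∀ {X X′ ws m} → X ⊆ X′ → Incidences S X ws m → Incidences S X′ ws m
    incidences-⊆ X⊆ []      = []
    incidences-⊆ X⊆ (s ∷ i) = slots-⊆ X⊆ s ∷ incidences-⊆ (λ { (here p) → here p ; (there q) → there (X⊆ q) }) i

    incidences-++ : ∀ {X ws ws′ m m′} → Incidences S X ws m → Incidences S X ws′ m′ → Incidences S X (ws ++ ws′) (m + m′)
    incidences-++ []                i′ = i′
    incidences-++ {m′ = m′} (_∷_ {k = k} {m} s i) i′ =
      subst (Incidences S _ _) (sym (+-assoc k m m′)) (s ∷ incidences-++ i (incidences-⊆ there i′))

    incidences-cover : (∀ {x y} → S x y → S y x) → ∀ {X ws m} → Incidences S X ws m →
      ∃ λ K → length K ≤ m × (∀ {w z} → w ∈ ws → w ∉ X → z ∉ X → Adj w z → S w z → Has K w z)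
    incidences-cover S-sym [] = [] , z≤n , λ ()
    incidences-cover S-sym {X} {h ∷ ws} (within Z Z≤ Z-cover ∷ i) with incidences-cover S-sym i
    ... | K , K≤ , K-cover = map (h ,_) Z ++ K
      , ≤-trans (≤-reflexive (≡-trans (length-++ (map (h ,_) Z)) (cong (_+ length K) (length-map (h ,_) Z)))) (+-mono-≤ Z≤ K≤)
      , cover
      where
      star : ∀ {z} → Adj h z → z ∉ X → S h z → Has (map (h ,_) Z ++ K) h z
      star hz z∉ Shz = inj₁ (∈-++⁺ˡ (∈-map⁺ (h ,_) (Z-cover hz z∉ Shz)))
      cover : ∀ {w z} → w ∈ h ∷ ws → w ∉ X → z ∉ X → Adj w z → S w z → Has (map (h ,_) Z ++ K) w z
      cover {w} {z} w∈ w∉ z∉ wz Swz with w ≟ᵛ h | z ≟ᵛ h | w∈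
      ... | yes refl | _        | _         = star wz z∉ Swz
      -- An edge from a later vertex back to `h` is already in the star of `h`.
      ... | no _     | yes refl | _         = has-sym (star (adj-sym wz) w∉ (S-sym Swz))
      ... | no w≢h   | no _     | here w≡h  = contradiction w≡h w≢h
      ... | no w≢h   | no z≢h   | there w∈′ = has-++ʳ (map (h ,_) Z)
        (K-cover w∈′ (λ { (here p) → w≢h p ; (there q) → w∉ q }) (λ { (here p) → z≢h p ; (there q) → z∉ q }) wz Swz)

  -- Claw-freeness and the neighbourhood of an edge

  module ClawFree (claw-free : Graph.ClawFree G) (Δ≤4 : Graph.MaxDegreeAtMost G 4) where

    claw : ∀ {x p q r} → Adj x p → Adj x q → Adj x r → p ≢ q → p ≢ r → q ≢ r → Adj p q ⊎ Adj p r ⊎ Adj q r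
    claw {x} {p} {q} {r} xp xq xr p≢q p≢r q≢r with adj? p q | adj? p r | adj? q r
    ... | yes pq | _      | _      = inj₁ pq
    ... | no _   | yes pr | _      = inj₂ (inj₁ pr)
    ... | no _   | no _   | yes qr = inj₂ (inj₂ qr)
    ... | no ¬pq | no ¬pr | no ¬qr = contradiction (¬pq , ¬pr , ¬qr) (claw-free x p q r xp xq xr p≢q p≢r q≢r)

    -- Otherwise `u` would be the centre of a claw with leaves `v`, `a` and `a′`.
    asides-adjacent : ∀ {u v a a′} → Adj u v → Aside u v a → Aside u v a′ → a ≢ a′ → Adj a a′
    asides-adjacent uv (ua , ¬va , a≢v) (ua′ , ¬va′ , a′≢v) a≢a′ with claw uv ua ua′ (≢-sym a≢v) (≢-sym a′≢v) a≢a′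
    ... | inj₁ va         = contradiction va ¬va
    ... | inj₂ (inj₁ va′) = contradiction va′ ¬va′
    ... | inj₂ (inj₂ aa′) = aa′

    all-nbrs : ∀ {w} {Y : List Vertex} → Unique Y → All (Adj w) Y → length Y ≤ 4
    all-nbrs {w} Y! wY = ≤-trans (Unique-⊆⇒length≤ {ys = nbrs w} Y! (∈-nbrs ∘ All.lookup wY)) (Δ≤4 w)

    -- Each known neighbour that lies in `X`, or is not joined to `w` by an edge of `S`, uses up one
    -- of the at most four places at `w`.
    slots : ∀ {S X w} (Y : List Vertex) → Unique Y → All (λ y → Adj w y × (y ∈ X ⊎ ¬ S w y)) Y →
            Slots S X w (4 ∸ length Y)
    slots {S} {X} {w} Y Y! Y-ok = within Z
      (m+n≤o⇒m≤o∸n (length Z) (subst (_≤ 4) (≡-trans (length-++ Y) (+-comm (length Y) _))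
          (all-nbrs (Unique.++⁺ Y! (Unique.filter⁺ new? (nbrs! w)) λ (p , q) → proj₂ (∈-filter⁻ new? {xs = nbrs w} q) p)
            (All.++⁺ (All.map proj₁ Y-ok)
              (All.tabulate λ z∈ → proj₂ (∈-filter⁻ (adj? w) {xs = allFin n} (proj₁ (∈-filter⁻ new? {xs = nbrs w} z∈))))))))
      λ wz z∉X Swz → ∈-filter⁺ new? (∈-nbrs wz) λ z∈Y → [ z∉X , (λ ¬Swz → ¬Swz Swz) ]′ (proj₂ (All.lookup Y-ok z∈Y))
      where
      new? : Decidable (_∉ Y)
      new? z = ¬? (z ∈ᵛ? Y)
      Z = filter new? (nbrs w)

    record OneCommon (u v : Vertex) : Set where
      field
        {c a₁ a₂ b₁ b₂}         : Vertex
        u~v                     : Adj u v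
        u~c                     : Adj u c
        v~c                     : Adj v c
        aside₁                  : Aside u v a₁
        aside₂                  : Aside u v a₂
        bside₁                  : Aside v u b₁
        bside₂                  : Aside v u b₂
        a₁≢a₂                   : a₁ ≢ a₂
        b₁≢b₂                   : b₁ ≢ b₂
        nbrs-u                  : ∀ {w} → Adj u w → w ∈ v ∷ c ∷ a₁ ∷ a₂ ∷ []
        nbrs-v                  : ∀ {w} → Adj v w → w ∈ u ∷ c ∷ b₁ ∷ b₂ ∷ []

      a₁~a₂ : Adj a₁ a₂
      a₁~a₂ = asides-adjacent u~v aside₁ aside₂ a₁≢a₂

      b₁~b₂ : Adj b₁ b₂
      b₁~b₂ = asides-adjacent (adj-sym u~v) bside₁ bside₂ b₁≢b₂

      near : ∀ {w} → w ≢ u → w ≢ v → Adj u w ⊎ Adj v w → w ∈ c ∷ a₁ ∷ a₂ ∷ b₁ ∷ b₂ ∷ []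
      near w≢u w≢v (inj₁ uw) with nbrs-u uw
      ... | here w≡v                          = contradiction w≡v w≢v
      ... | there (here p)                    = here p
      ... | there (there (here p))            = there (here p)
      ... | there (there (there (here p)))    = there (there (here p))
      near w≢u w≢v (inj₂ vw) with nbrs-v vw
      ... | here w≡u                          = contradiction w≡u w≢u
      ... | there (here p)                    = here p
      ... | there (there q)                   = there (there (there q))

      common-c : ∀ {w} → Adj u w → Adj v w → w ≡ c
      common-c uw vw with nbrs-u uw
      ... | here refl                         = contradiction vw adj-irrefl
      ... | there (here p)                    = p
      ... | there (there (here refl))         = contradiction vw (proj₁ (proj₂ aside₁))
      ... | there (there (there (here refl))) = contradiction vw (proj₁ (proj₂ aside₂))

      aside-∈ : ∀ {a} → Aside u v a → a ≡ a₁ ⊎ a ≡ a₂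
      aside-∈ (ua , ¬va , a≢v) with nbrs-u ua
      ... | here p                            = contradiction p a≢v
      ... | there (here refl)                 = contradiction v~c ¬va
      ... | there (there (here p))            = inj₁ p
      ... | there (there (there (here p)))    = inj₂ p

      c≢a₁ : c ≢ a₁
      c≢a₁ = separated v~c (proj₁ (proj₂ aside₁))

      u≢v : u ≢ v
      u≢v = adj⇒≢ u~v

      swap-a : OneCommon u v
      swap-a = record
        { u~v = u~v ; u~c = u~c ; v~c = v~c ; aside₁ = aside₂ ; aside₂ = aside₁ ; bside₁ = bside₁ ; bside₂ = bside₂
        ; a₁≢a₂ = ≢-sym a₁≢a₂ ; b₁≢b₂ = b₁≢b₂ ; nbrs-v = nbrs-v
        ; nbrs-u = ∈-resp-↭ (prep _ (prep _ (swap _ _ ↭-refl))) ∘ nbrs-u }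

      swap-uv : OneCommon v u
      swap-uv = record
        { u~v = adj-sym u~v ; u~c = v~c ; v~c = u~c ; aside₁ = bside₁ ; aside₂ = bside₂ ; bside₁ = aside₁ ; bside₂ = aside₂
        ; a₁≢a₂ = b₁≢b₂ ; b₁≢b₂ = a₁≢a₂ ; nbrs-u = nbrs-v ; nbrs-v = nbrs-u }

      swap-b : OneCommon u v
      swap-b = record
        { u~v = u~v ; u~c = u~c ; v~c = v~c ; aside₁ = aside₁ ; aside₂ = aside₂ ; bside₁ = bside₂ ; bside₂ = bside₁
        ; a₁≢a₂ = a₁≢a₂ ; b₁≢b₂ = ≢-sym b₁≢b₂ ; nbrs-u = nbrs-u
        ; nbrs-v = ∈-resp-↭ (prep _ (prep _ (swap _ _ ↭-refl))) ∘ nbrs-v }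

    -- The other neighbourhood for which the plain count reaches 13: two triangles on `uv` and one
    -- further neighbour at each end. It is refuted in `NoTwoCommon`.
    record TwoCommon (u v : Vertex) : Set where
      field
        {c₁ c₂ a b} : Vertex
        u~v         : Adj u v
        u~c₁        : Adj u c₁
        v~c₁        : Adj v c₁
        u~c₂        : Adj u c₂
        v~c₂        : Adj v c₂
        c₁≢c₂       : c₁ ≢ c₂
        aside       : Aside u v a
        bside       : Aside v u b
        nbrs-u      : ∀ {w} → Adj u w → w ∈ v ∷ c₁ ∷ c₂ ∷ a ∷ []
        nbrs-v      : ∀ {w} → Adj v w → w ∈ u ∷ c₁ ∷ c₂ ∷ b ∷ []

      near : ∀ {w} → w ≢ u → w ≢ v → Adj u w ⊎ Adj v w → w ∈ c₁ ∷ c₂ ∷ a ∷ b ∷ []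
      near w≢u w≢v (inj₁ uw) with nbrs-u uw
      ... | here w≡v                          = contradiction w≡v w≢v
      ... | there (here p)                    = here p
      ... | there (there (here p))            = there (here p)
      ... | there (there (there (here p)))    = there (there (here p))
      near w≢u w≢v (inj₂ vw) with nbrs-v vw
      ... | here w≡u                          = contradiction w≡u w≢u
      ... | there (here p)                    = here p
      ... | there (there (here p))            = there (here p)
      ... | there (there (there (here p)))    = there (there (there (here p)))

      common-c : ∀ {w} → Adj u w → Adj v w → w ≡ c₁ ⊎ w ≡ c₂
      common-c uw vw with nbrs-u uw
      ... | here refl                         = contradiction vw adj-irrefl
      ... | there (here p)                    = inj₁ p
      ... | there (there (here p))            = inj₂ p
      ... | there (there (there (here refl))) = contradiction vw (proj₁ (proj₂ aside))

      swap-c : TwoCommon u v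
      swap-c = record
        { u~v = u~v ; u~c₁ = u~c₂ ; v~c₁ = v~c₂ ; u~c₂ = u~c₁ ; v~c₂ = v~c₁ ; c₁≢c₂ = ≢-sym c₁≢c₂
        ; aside = aside ; bside = bside
        ; nbrs-u = ∈-resp-↭ (prep _ (swap _ _ ↭-refl)) ∘ nbrs-u
        ; nbrs-v = ∈-resp-↭ (prep _ (swap _ _ ↭-refl)) ∘ nbrs-v }

      swap-uv : TwoCommon v u
      swap-uv = record
        { u~v = adj-sym u~v ; u~c₁ = v~c₁ ; v~c₁ = u~c₁ ; u~c₂ = v~c₂ ; v~c₂ = u~c₂ ; c₁≢c₂ = c₁≢c₂
        ; aside = bside ; bside = aside ; nbrs-u = nbrs-v ; nbrs-v = nbrs-u }

    record Neighbourhood (u v : Vertex) (T A B : List Vertex) : Set where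
      field
        T!      : Unique T
        A!      : Unique A
        B!      : Unique B
        commons : All (λ c → Adj u c × Adj v c) T
        asides  : All (Aside u v) A
        bsides  : All (Aside v u) B
        nbrs-u  : ∀ {w} → Adj u w → w ∈ v ∷ T ++ A
        nbrs-v  : ∀ {w} → Adj v w → w ∈ u ∷ T ++ B
        |T+A|   : length T + length A ≤ 3
        |T+B|   : length T + length B ≤ 3

    neighbourhood : ∀ {u v} → Adj u v → ∃ λ T → ∃₂ λ A B → Neighbourhood u v T A B
    neighbourhood {u} {v} uv = T , A , B , record
      { T! = T! ; A! = A! u v ; B! = A! v u ; commons = commons ; asides = asides u v ; bsides = asides v u
      ; nbrs-u = complete T∋ ; nbrs-v = complete (λ vw uw → T∋ uw vw)
      ; |T+A| = count commons uv ; |T+B| = count (All.map (λ (p , q) → q , p) commons) (adj-sym uv) }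
      where
      common? : Decidable (λ c → Adj u c × Adj v c)
      common? c = adj? u c ×-dec adj? v c
      T = filter common? (allFin n)
      side : Vertex → Vertex → List Vertex
      side u v = filter (aside? u v) (allFin n)
      A = side u v
      B = side v u
      T! : Unique T
      T! = Unique.filter⁺ common? (Unique.allFin⁺ n)
      A! : ∀ u v → Unique (side u v)
      A! u v = Unique.filter⁺ (aside? u v) (Unique.allFin⁺ n)
      commons : All (λ c → Adj u c × Adj v c) T
      commons = All.tabulate (proj₂ ∘ ∈-filter⁻ common? {xs = allFin n})
      asides : ∀ u v → All (Aside u v) (side u v)
      asides u v = All.tabulate (proj₂ ∘ ∈-filter⁻ (aside? u v) {xs = allFin n})
      T∋ : ∀ {w} → Adj u w → Adj v w → w ∈ T
      T∋ {w} uw vw = ∈-filter⁺ common? (∈-allFin w) (uw , vw)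
      complete : ∀ {u v} → (∀ {w} → Adj u w → Adj v w → w ∈ T) → ∀ {w} → Adj u w → w ∈ v ∷ T ++ side u v
      complete {u} {v} T∋ {w} uw with adj? v w | w ≟ᵛ v
      ... | yes vw | _       = there (∈-++⁺ˡ (T∋ uw vw))
      ... | no _   | yes w≡v = here w≡v
      ... | no ¬vw | no w≢v  = there (∈-++⁺ʳ T (∈-filter⁺ (aside? u v) (∈-allFin w) (uw , ¬vw , w≢v)))
      count : ∀ {u v} → All (λ c → Adj u c × Adj v c) T → Adj u v → length T + length (side u v) ≤ 3
      count {u} {v} T-ok uv = s≤s⁻¹ (subst (λ k → suc k ≤ 4) (length-++ T) (all-nbrs {w = u} (v∉ ∷ TA!) (uv ∷ u~)))
        where
        disjoint : ∀ {w} → ¬ (w ∈ T × w ∈ side u v)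
        disjoint (p , q) = proj₁ (proj₂ (All.lookup (asides u v) q)) (proj₂ (All.lookup T-ok p))
        TA! : Unique (T ++ side u v)
        TA! = Unique.++⁺ T! (A! u v) disjoint
        v∉ : All (v ≢_) (T ++ side u v)
        v∉ = All.++⁺ (All.map (λ (_ , vc) → adj⇒≢ vc) T-ok) (All.map (λ (_ , _ , a≢v) → ≢-sym a≢v) (asides u v))
        u~ : All (Adj u) (T ++ side u v)
        u~ = All.++⁺ (All.map proj₁ T-ok) (All.map proj₁ (asides u v))

    -- The counts it refutes are mostly closed numerals, for which the implicit argument is found by
    -- evaluating `m <? 13`.
    few : ∀ {m} {_ : True (m <? 13)} → ¬ 13 ≤ m
    few {m} {m<13} = <⇒≱ (toWitness m<13)

    -- The sums 3, 3 + 2 and 3 + 2 + 1: the asides of an end form a clique and are adjacent to that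
    -- end, so each has one uncounted edge fewer than the one before.
    side-bound : ℕ → ℕ
    side-bound 0 = 0
    side-bound 1 = 3
    side-bound 2 = 5
    side-bound _ = 6

    side-bound≤6 : ∀ a → side-bound a ≤ 6
    side-bound≤6 0 = z≤n
    side-bound≤6 1 = toWitness {a? = 3 ≤? 6} _
    side-bound≤6 2 = toWitness {a? = 5 ≤? 6} _
    side-bound≤6 (suc (suc (suc _))) = ≤-refl

    -- Each of `t` common neighbours accounts for two edges back to `u` and `v` and at most two
    -- others; `a` and `b` are the numbers of asides. Both `t = 0` and `t = 3` give at most 12, and
    -- the two surviving cases give 14.
    crowded : ∀ t a b → t + a ≤ 3 → t + b ≤ 3 → 13 ≤ 2 * t + (2 * t + (side-bound a + side-bound b)) →
              (t ≡ 1 × a ≡ 2 × b ≡ 2) ⊎ (t ≡ 2 × a ≡ 1 × b ≡ 1)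
    crowded 0 a b _ _ h = contradiction (≤-trans h (+-mono-≤ (side-bound≤6 a) (side-bound≤6 b))) few
    crowded 1 0 0 _ _ h = contradiction h few
    crowded 1 0 1 _ _ h = contradiction h few
    crowded 1 0 2 _ _ h = contradiction h few
    crowded 1 1 0 _ _ h = contradiction h few
    crowded 1 1 1 _ _ h = contradiction h few
    crowded 1 1 2 _ _ h = contradiction h few
    crowded 1 2 0 _ _ h = contradiction h few
    crowded 1 2 1 _ _ h = contradiction h few
    crowded 1 2 2 _ _ h = inj₁ (refl , refl , refl)
    crowded 1 (suc (suc (suc a))) _ (s≤s (s≤s (s≤s ()))) _ _
    crowded 1 _ (suc (suc (suc b))) _ (s≤s (s≤s (s≤s ()))) _
    crowded 2 0 0 _ _ h = contradiction h few
    crowded 2 0 1 _ _ h = contradiction h few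
    crowded 2 1 0 _ _ h = contradiction h few
    crowded 2 1 1 _ _ h = inj₂ (refl , refl , refl)
    crowded 2 (suc (suc a)) _ (s≤s (s≤s (s≤s ()))) _ _
    crowded 2 _ (suc (suc b)) _ (s≤s (s≤s (s≤s ()))) _
    crowded 3 0 0 _ _ h = contradiction h few
    crowded 3 (suc a) _ (s≤s (s≤s (s≤s ()))) _ _
    crowded 3 _ (suc b) _ (s≤s (s≤s (s≤s ()))) _
    crowded (suc (suc (suc (suc t)))) _ _ (s≤s (s≤s (s≤s ()))) _ _

    -- Sets of edges of minimum conflict degree 13

    module Core {F : List Edge} (F! : Unique F) (F-edges : Oriented F) (dense : ∀ {e} → e ∈ F → 13 ≤ degree e F) where

      has⇒adj : ∀ {x y} → Has F x y → Adj x y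
      has⇒adj (inj₁ xy∈) = proj₂ (F-edges xy∈)
      has⇒adj (inj₂ yx∈) = adj-sym (proj₂ (F-edges yx∈))

      has-dense : ∀ {u v} → Has F u v → 13 ≤ degree (u , v) F
      has-dense (inj₁ uv∈) = dense uv∈
      has-dense {u} {v} (inj₂ vu∈) = ≤-trans (dense vu∈)
        (Unique-⊆⇒length≤ {ys = neighbours (u , v) F} (Unique.filter⁺ (conf? (v , u)) F!) λ {f} f∈ →
          let f∈F , vu-f = ∈-neighbours⁻ {v , u} {f} {F} f∈ in ∈-neighbours⁺ {u , v} f∈F (conf-swapˡ {v} {u} {f} vu-f))

      -- Edges back to `u` or `v` are listed in `triangles`, since the incidences avoid both ends.
      -- Asking only for the listing of edges in `F` allows `triangles` to omit an edge that is
      -- known not to belong to `F`.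
      degree-bound : ∀ {u v ws m triangles} →
        (∀ {w} → w ≢ u → w ≢ v → Adj u w ⊎ Adj v w → w ∈ ws) →
        (∀ {c} → Adj u c → Adj v c → (Has F c u → Has triangles c u) × (Has F c v → Has triangles c v)) →
        Incidences (Has F) (u ∷ v ∷ []) ws m → degree (u , v) F ≤ length triangles + m
      degree-bound {u} {v} {ws} {m} {triangles} near triangle incidences with incidences-cover has-sym incidences
      ... | K , K≤ , K-cover = ≤-trans
        (cover-length (Unique.filter⁺ (conf? (u , v)) F!) (λ f∈ → F-edges (proj₁ (∈-neighbours⁻ {u , v} f∈))) cover)
        (≤-trans (≤-reflexive (length-++ triangles)) (+-monoʳ-≤ (length triangles) K≤))
        where
        avoid : ∀ {w} → w ≢ u → w ≢ v → w ∉ u ∷ v ∷ []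
        avoid w≢u w≢v (here p)         = w≢u p
        avoid w≢u w≢v (there (here p)) = w≢v p
        touch : ∀ {w z} → Has F w z → Touches u v w z → Has (triangles ++ K) w z
        touch wz (w≢u , w≢v , inj₁ (uvw , z≢u , z≢v)) =
          has-++ʳ triangles (K-cover (near w≢u w≢v uvw) (avoid w≢u w≢v) (avoid z≢u z≢v) (has⇒adj wz) wz)
        touch wz (_ , _ , inj₂ ((uw , vw) , inj₁ refl)) = has-++ˡ (proj₁ (triangle uw vw) wz)
        touch wz (_ , _ , inj₂ ((uw , vw) , inj₂ refl)) = has-++ˡ (proj₂ (triangle uw vw) wz)
        cover : ∀ {x y} → (x , y) ∈ neighbours (u , v) F → Has (triangles ++ K) x y
        cover xy∈ with ∈-neighbours⁻ {u , v} xy∈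
        ... | xy∈F , conflict with conflict⇒touches (proj₂ (F-edges xy∈F)) conflict
        ...   | inj₁ t = touch (inj₁ xy∈F) t
        ...   | inj₂ t = has-sym (touch (inj₂ xy∈F) t)

      clique-incidences : ∀ {u v X A} → u ∈ X → Adj u v → Unique A → All (Aside u v) A → length A ≤ 3 →
                          Incidences (Has F) X A (side-bound (length A))
      clique-incidences {A = []} _ _ _ _ _ = []
      clique-incidences {A = a ∷ []} u∈ uv _ ((ua , _) ∷ []) _ =
        slots (_ ∷ []) ([] ∷ []) ((adj-sym ua , inj₁ u∈) ∷ []) ∷ []
      clique-incidences {A = a ∷ a′ ∷ []} u∈ uv ((a≢a′ ∷ []) ∷ _) (s@(ua , _) ∷ s′@(ua′ , _) ∷ []) _ =
        slots (_ ∷ []) ([] ∷ []) ((adj-sym ua , inj₁ u∈) ∷ []) ∷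
        slots (_ ∷ a ∷ []) ((adj⇒≢ ua ∷ []) ∷ [] ∷ [])
          ((adj-sym ua′ , inj₁ (there u∈)) ∷ (adj-sym (asides-adjacent uv s s′ a≢a′) , inj₁ (here refl)) ∷ []) ∷ []
      clique-incidences {A = a ∷ a′ ∷ a″ ∷ []} u∈ uv ((a≢a′ ∷ a≢a″ ∷ []) ∷ (a′≢a″ ∷ []) ∷ _)
        (s@(ua , _) ∷ s′@(ua′ , _) ∷ s″@(ua″ , _) ∷ []) _ =
        slots (_ ∷ []) ([] ∷ []) ((adj-sym ua , inj₁ u∈) ∷ []) ∷
        slots (_ ∷ a ∷ []) ((adj⇒≢ ua ∷ []) ∷ [] ∷ [])
          ((adj-sym ua′ , inj₁ (there u∈)) ∷ (adj-sym (asides-adjacent uv s s′ a≢a′) , inj₁ (here refl)) ∷ []) ∷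
        slots (_ ∷ a ∷ a′ ∷ []) ((adj⇒≢ ua ∷ adj⇒≢ ua′ ∷ []) ∷ (a≢a′ ∷ []) ∷ [] ∷ [])
          ((adj-sym ua″ , inj₁ (there (there u∈))) ∷ (adj-sym (asides-adjacent uv s s″ a≢a″) , inj₁ (there (here refl))) ∷
           (adj-sym (asides-adjacent uv s′ s″ a′≢a″) , inj₁ (here refl)) ∷ []) ∷ []
      clique-incidences {A = _ ∷ _ ∷ _ ∷ _ ∷ _} _ _ _ _ (s≤s (s≤s (s≤s ())))

      common-incidences : ∀ {u v X} T → u ∈ X → v ∈ X → u ≢ v → All (λ c → Adj u c × Adj v c) T →
                          Incidences (Has F) X T (length T * 2)
      common-incidences []      _  _  _   _                = []
      common-incidences (c ∷ T) u∈ v∈ u≢v ((uc , vc) ∷ ok) =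
        slots (_ ∷ _ ∷ []) ((u≢v ∷ []) ∷ [] ∷ []) ((adj-sym uc , inj₁ u∈) ∷ (adj-sym vc , inj₁ v∈) ∷ []) ∷
        common-incidences T (there u∈) (there v∈) u≢v ok

      neighbourhood-bound : ∀ {u v T A B} → Adj u v → Neighbourhood u v T A B →
        degree (u , v) F ≤ 2 * length T + (2 * length T + (side-bound (length A) + side-bound (length B)))
      neighbourhood-bound {u} {v} {T} {A} {B} uv nb =
        subst₂ (λ s t → degree (u , v) F ≤ s + (t + (side-bound (length A) + side-bound (length B))))
          (≡-trans (triangles-length T) (*-comm (length T) 2)) (*-comm (length T) 2)
          (degree-bound near (λ {c} uc vc → triangle {c} (T∋ uc vc))
            (incidences-++ (common-incidences T (here refl) (there (here refl)) (adj⇒≢ uv) commons)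
              (incidences-++ (clique-incidences (here refl) uv A! asides (≤-trans (m≤n+m _ (length T)) |T+A|))
                (clique-incidences (there (here refl)) (adj-sym uv) B! bsides (≤-trans (m≤n+m _ (length T)) |T+B|)))))
        where
        open Neighbourhood nb
        triangles : List Vertex → List Edge
        triangles []      = []
        triangles (c ∷ T) = (c , u) ∷ (c , v) ∷ triangles T
        triangles-length : ∀ T → length (triangles T) ≡ length T * 2
        triangles-length []      = refl
        triangles-length (_ ∷ T) = cong (2 +_) (triangles-length T)
        near : ∀ {w} → w ≢ u → w ≢ v → Adj u w ⊎ Adj v w → w ∈ T ++ A ++ B
        near w≢u w≢v (inj₁ uw) with nbrs-u uw
        ... | here w≡v = contradiction w≡v w≢v
        ... | there p  = [ ∈-++⁺ˡ , ∈-++⁺ʳ T ∘ ∈-++⁺ˡ ]′ (∈-++⁻ T p)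
        near w≢u w≢v (inj₂ vw) with nbrs-v vw
        ... | here w≡u = contradiction w≡u w≢u
        ... | there p  = [ ∈-++⁺ˡ , ∈-++⁺ʳ T ∘ ∈-++⁺ʳ A ]′ (∈-++⁻ T p)
        T∋ : ∀ {c} → Adj u c → Adj v c → c ∈ T
        T∋ uc vc with nbrs-u uc
        ... | here refl = contradiction vc adj-irrefl
        ... | there p with ∈-++⁻ T p
        ...   | inj₁ c∈T = c∈T
        ...   | inj₂ c∈A = contradiction vc (proj₁ (proj₂ (All.lookup asides c∈A)))
        triangle∋ : ∀ {c T} → c ∈ T → (c , u) ∈ triangles T × (c , v) ∈ triangles T
        triangle∋ (here refl) = here refl , there (here refl)
        triangle∋ (there c∈)  = let p , q = triangle∋ c∈ in there (there p) , there (there q)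
        triangle : ∀ {c} → c ∈ T → (Has F c u → Has (triangles T) c u) × (Has F c v → Has (triangles T) c v)
        triangle c∈ = (λ _ → inj₁ (proj₁ (triangle∋ c∈))) , (λ _ → inj₁ (proj₂ (triangle∋ c∈)))

      classify : ∀ {u v} → Has F u v → OneCommon u v ⊎ TwoCommon u v
      classify {u} {v} uv with neighbourhood (has⇒adj uv)
      ... | T , A , B , nb with crowded (length T) (length A) (length B) (Neighbourhood.|T+A| nb) (Neighbourhood.|T+B| nb)
                                  (≤-trans (has-dense uv) (neighbourhood-bound (has⇒adj uv) nb))
      ... | inj₁ (t , a , b) = inj₁ (one nb t a b)
        where
        one : ∀ {T A B} → Neighbourhood u v T A B → length T ≡ 1 → length A ≡ 2 → length B ≡ 2 → OneCommon u v
        one {_ ∷ []} {_ ∷ _ ∷ []} {_ ∷ _ ∷ []}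
          record { commons = (uc , vc) ∷ [] ; asides = s₁ ∷ s₂ ∷ [] ; bsides = t₁ ∷ t₂ ∷ [] ; nbrs-u = nbrs-u ; nbrs-v = nbrs-v
                 ; A! = (a≢ ∷ []) ∷ _ ; B! = (b≢ ∷ []) ∷ _ } refl refl refl = record
          { u~v = has⇒adj uv ; u~c = uc ; v~c = vc ; aside₁ = s₁ ; aside₂ = s₂ ; bside₁ = t₁ ; bside₂ = t₂
          ; a₁≢a₂ = a≢ ; b₁≢b₂ = b≢ ; nbrs-u = nbrs-u ; nbrs-v = nbrs-v }
      ... | inj₂ (t , a , b) = inj₂ (two nb t a b)
        where
        two : ∀ {T A B} → Neighbourhood u v T A B → length T ≡ 2 → length A ≡ 1 → length B ≡ 1 → TwoCommon u v
        two {_ ∷ _ ∷ []} {_ ∷ []} {_ ∷ []}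
          record { commons = (uc₁ , vc₁) ∷ (uc₂ , vc₂) ∷ [] ; asides = s ∷ [] ; bsides = t ∷ [] ; nbrs-u = nbrs-u ; nbrs-v = nbrs-v
                 ; T! = (c≢ ∷ []) ∷ _ } refl refl refl = record
          { u~v = has⇒adj uv ; u~c₁ = uc₁ ; v~c₁ = vc₁ ; u~c₂ = uc₂ ; v~c₂ = vc₂ ; c₁≢c₂ = c≢
          ; aside = s ; bside = t ; nbrs-u = nbrs-u ; nbrs-v = nbrs-v }

      one-common-bound : ∀ {u v} (o : OneCommon u v) → let open OneCommon o in
        ∀ {m} → Incidences (Has F) (u ∷ v ∷ []) (c ∷ a₁ ∷ a₂ ∷ b₁ ∷ b₂ ∷ []) m → degree (u , v) F ≤ 2 + m
      one-common-bound {u} {v} o = degree-bound near triangle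
        where
        open OneCommon o
        triangle : ∀ {x} → Adj u x → Adj v x → (Has F x u → Has ((c , u) ∷ (c , v) ∷ []) x u) × (Has F x v → Has ((c , u) ∷ (c , v) ∷ []) x v)
        triangle ux vx with common-c ux vx
        ... | refl = (λ _ → inj₁ #0) , (λ _ → inj₁ #1)

      -- The suffix of a slot's name lists the further earlier neighbours it takes into account.
      module OneCommonSlots {u v : Vertex} (o : OneCommon u v) where
        open OneCommon o

        c-slot : Slots (Has F) (u ∷ v ∷ []) c 2
        c-slot = slots (u ∷ v ∷ []) ((u≢v ∷ []) ∷ [] ∷ []) ((adj-sym u~c , inj₁ #0) ∷ (adj-sym v~c , inj₁ #1) ∷ [])

        a₁-slot : Slots (Has F) (c ∷ u ∷ v ∷ []) a₁ 3
        a₁-slot = slots (u ∷ []) ([] ∷ []) ((adj-sym (proj₁ aside₁) , inj₁ #1) ∷ [])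

        a₁-slot-c : Adj c a₁ → Slots (Has F) (c ∷ u ∷ v ∷ []) a₁ 2
        a₁-slot-c ca = slots (u ∷ c ∷ []) ((adj⇒≢ u~c ∷ []) ∷ [] ∷ [])
          ((adj-sym (proj₁ aside₁) , inj₁ #1) ∷ (adj-sym ca , inj₁ #0) ∷ [])

        a₂-slot : Slots (Has F) (a₁ ∷ c ∷ u ∷ v ∷ []) a₂ 2
        a₂-slot = slots (u ∷ a₁ ∷ []) ((adj⇒≢ (proj₁ aside₁) ∷ []) ∷ [] ∷ [])
          ((adj-sym (proj₁ aside₂) , inj₁ #2) ∷ (adj-sym a₁~a₂ , inj₁ #0) ∷ [])

        a₂-slot-c : Adj c a₂ → Slots (Has F) (a₁ ∷ c ∷ u ∷ v ∷ []) a₂ 1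
        a₂-slot-c ca = slots (u ∷ a₁ ∷ c ∷ []) ((adj⇒≢ (proj₁ aside₁) ∷ adj⇒≢ u~c ∷ []) ∷ (≢-sym c≢a₁ ∷ []) ∷ [] ∷ [])
          ((adj-sym (proj₁ aside₂) , inj₁ #2) ∷ (adj-sym a₁~a₂ , inj₁ #0) ∷ (adj-sym ca , inj₁ #1) ∷ [])

        b₁-slot : Slots (Has F) (a₂ ∷ a₁ ∷ c ∷ u ∷ v ∷ []) b₁ 3
        b₁-slot = slots (v ∷ []) ([] ∷ []) ((adj-sym (proj₁ bside₁) , inj₁ #4) ∷ [])

        b₁-slot-a₁ : Adj a₁ b₁ → Slots (Has F) (a₂ ∷ a₁ ∷ c ∷ u ∷ v ∷ []) b₁ 2
        b₁-slot-a₁ ab = slots (v ∷ a₁ ∷ []) ((≢-sym (proj₂ (proj₂ aside₁)) ∷ []) ∷ [] ∷ [])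
          ((adj-sym (proj₁ bside₁) , inj₁ #4) ∷ (adj-sym ab , inj₁ #1) ∷ [])

        b₁-slot-a₁a₂ : Adj a₁ b₁ → Adj a₂ b₁ → Slots (Has F) (a₂ ∷ a₁ ∷ c ∷ u ∷ v ∷ []) b₁ 1
        b₁-slot-a₁a₂ ab a′b = slots (v ∷ a₁ ∷ a₂ ∷ [])
          ((≢-sym (proj₂ (proj₂ aside₁)) ∷ ≢-sym (proj₂ (proj₂ aside₂)) ∷ []) ∷ (a₁≢a₂ ∷ []) ∷ [] ∷ [])
          ((adj-sym (proj₁ bside₁) , inj₁ #4) ∷ (adj-sym ab , inj₁ #1) ∷ (adj-sym a′b , inj₁ #0) ∷ [])

        b₂-slot : Slots (Has F) (b₁ ∷ a₂ ∷ a₁ ∷ c ∷ u ∷ v ∷ []) b₂ 2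
        b₂-slot = slots (v ∷ b₁ ∷ []) ((adj⇒≢ (proj₁ bside₁) ∷ []) ∷ [] ∷ [])
          ((adj-sym (proj₁ bside₂) , inj₁ #5) ∷ (adj-sym b₁~b₂ , inj₁ #0) ∷ [])

        b₂-slot-a : ∀ {a} → Aside u v a → a ∈ a₂ ∷ a₁ ∷ [] → Adj a b₂ → Slots (Has F) (b₁ ∷ a₂ ∷ a₁ ∷ c ∷ u ∷ v ∷ []) b₂ 1
        b₂-slot-a {a} (ua , _ , a≢v) a∈ ab = slots (v ∷ b₁ ∷ a ∷ [])
          ((adj⇒≢ (proj₁ bside₁) ∷ ≢-sym a≢v ∷ []) ∷ (≢-sym (separated ua (proj₁ (proj₂ bside₁))) ∷ []) ∷ [] ∷ [])
          ((adj-sym (proj₁ bside₂) , inj₁ #5) ∷ (adj-sym b₁~b₂ , inj₁ #0) ∷ (adj-sym ab , inj₁ (there (∈-++⁺ˡ a∈))) ∷ [])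

      abstract
        full-nbrs : ∀ {w z} {Y : List Vertex} → Unique Y → All (Adj w) Y → length Y ≡ 4 → Adj w z → z ∈ Y
        full-nbrs {z = z} {Y} Y! wY |Y| wz = decidable-stable (z ∈ᵛ? Y) λ z∉ →
          contradiction (all-nbrs (∉⇒All≢ z∉ ∷ Y!) (wz ∷ wY)) (<⇒≱ (≤-reflexive (cong suc (sym |Y|))))

      -- No edge of `F` lies in two triangles

      module TwoCommonSlots {u v : Vertex} (uv : Has F u v) (t : TwoCommon u v) where
        open TwoCommon t

        bound : ∀ {m} → Incidences (Has F) (u ∷ v ∷ []) (c₁ ∷ c₂ ∷ a ∷ b ∷ []) m → 13 ≤ 4 + m
        bound i = ≤-trans (has-dense uv) (degree-bound {triangles = (c₁ , u) ∷ (c₁ , v) ∷ (c₂ , u) ∷ (c₂ , v) ∷ []} near triangle i)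
          where
          triangle : ∀ {x} → Adj u x → Adj v x → (Has F x u → Has _ x u) × (Has F x v → Has _ x v)
          triangle ux vx with common-c ux vx
          ... | inj₁ refl = (λ _ → inj₁ #0) , (λ _ → inj₁ #1)
          ... | inj₂ refl = (λ _ → inj₁ #2) , (λ _ → inj₁ #3)

        u≢v : u ≢ v
        u≢v = adj⇒≢ u~v
        c₁≢b : c₁ ≢ b
        c₁≢b = separated u~c₁ (proj₁ (proj₂ bside))
        c₂≢b : c₂ ≢ b
        c₂≢b = separated u~c₂ (proj₁ (proj₂ bside))

        c₁-slot : Slots (Has F) (u ∷ v ∷ []) c₁ 2
        c₁-slot = slots (u ∷ v ∷ []) ((u≢v ∷ []) ∷ [] ∷ []) ((adj-sym u~c₁ , inj₁ #0) ∷ (adj-sym v~c₁ , inj₁ #1) ∷ [])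
        c₂-slot : Slots (Has F) (c₁ ∷ u ∷ v ∷ []) c₂ 2
        c₂-slot = slots (u ∷ v ∷ []) ((u≢v ∷ []) ∷ [] ∷ []) ((adj-sym u~c₂ , inj₁ #1) ∷ (adj-sym v~c₂ , inj₁ #2) ∷ [])
        c₂-slot-c₁ : Adj c₁ c₂ → Slots (Has F) (c₁ ∷ u ∷ v ∷ []) c₂ 1
        c₂-slot-c₁ cc = slots (u ∷ v ∷ c₁ ∷ []) ((u≢v ∷ adj⇒≢ u~c₁ ∷ []) ∷ (adj⇒≢ v~c₁ ∷ []) ∷ [] ∷ [])
          ((adj-sym u~c₂ , inj₁ #1) ∷ (adj-sym v~c₂ , inj₁ #2) ∷ (adj-sym cc , inj₁ #0) ∷ [])
        a-slot : Slots (Has F) (c₂ ∷ c₁ ∷ u ∷ v ∷ []) a 3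
        a-slot = slots (u ∷ []) ([] ∷ []) ((adj-sym (proj₁ aside) , inj₁ #2) ∷ [])
        a-slot-c₁ : Adj c₁ a → Slots (Has F) (c₂ ∷ c₁ ∷ u ∷ v ∷ []) a 2
        a-slot-c₁ ca = slots (u ∷ c₁ ∷ []) ((adj⇒≢ u~c₁ ∷ []) ∷ [] ∷ [])
          ((adj-sym (proj₁ aside) , inj₁ #2) ∷ (adj-sym ca , inj₁ #1) ∷ [])
        b-slot : Slots (Has F) (a ∷ c₂ ∷ c₁ ∷ u ∷ v ∷ []) b 3
        b-slot = slots (v ∷ []) ([] ∷ []) ((adj-sym (proj₁ bside) , inj₁ #4) ∷ [])
        b-slot-c₁ : Adj c₁ b → Slots (Has F) (a ∷ c₂ ∷ c₁ ∷ u ∷ v ∷ []) b 2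
        b-slot-c₁ cb = slots (v ∷ c₁ ∷ []) ((adj⇒≢ v~c₁ ∷ []) ∷ [] ∷ [])
          ((adj-sym (proj₁ bside) , inj₁ #4) ∷ (adj-sym cb , inj₁ #2) ∷ [])
        b-slot-c₂ : Adj c₂ b → Slots (Has F) (a ∷ c₂ ∷ c₁ ∷ u ∷ v ∷ []) b 2
        b-slot-c₂ cb = slots (v ∷ c₂ ∷ []) ((adj⇒≢ v~c₂ ∷ []) ∷ [] ∷ [])
          ((adj-sym (proj₁ bside) , inj₁ #4) ∷ (adj-sym cb , inj₁ #1) ∷ [])

        -- The plain count is 4 + 2 + 2 + 3 + 3 = 14. The edge `c₁a` saves one, and the adjacency
        -- forced among `c₁`, `c₂`, `b` around `v` saves another.
        c₁≁a : ¬ Adj c₁ a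
        c₁≁a ca with claw v~c₁ v~c₂ (proj₁ bside) c₁≢c₂ c₁≢b c₂≢b
        ... | inj₁ cc        = few (bound (c₁-slot ∷ c₂-slot-c₁ cc ∷ a-slot-c₁ ca ∷ b-slot ∷ []))
        ... | inj₂ (inj₁ cb) = few (bound (c₁-slot ∷ c₂-slot ∷ a-slot-c₁ ca ∷ b-slot-c₁ cb ∷ []))
        ... | inj₂ (inj₂ cb) = few (bound (c₁-slot ∷ c₂-slot ∷ a-slot-c₁ ca ∷ b-slot-c₂ cb ∷ []))

      -- An edge wd leaving a K₄ on w, u, v, c has degree at most 12, hence is not in F.
      module LeavingK₄ {u v c w d : Vertex} (w~u : Adj w u) (w~v : Adj w v) (w~c : Adj w c) (u~v : Adj u v) (u~c : Adj u c) (v~c : Adj v c)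
        (d≢c : d ≢ c) (d≢u : d ≢ u) (d≢v : d ≢ v) (d≁u : ¬ Adj d u) (d≁v : ¬ Adj d v) (wd : Has F w d) where

        nbrs-w : ∀ {z} → Adj w z → z ∈ u ∷ v ∷ c ∷ d ∷ []
        nbrs-w = full-nbrs
          ((adj⇒≢ u~v ∷ adj⇒≢ u~c ∷ ≢-sym d≢u ∷ []) ∷ (adj⇒≢ v~c ∷ ≢-sym d≢v ∷ []) ∷ (≢-sym d≢c ∷ []) ∷ [] ∷ [])
          (w~u ∷ w~v ∷ w~c ∷ has⇒adj wd ∷ []) refl

        common : ∀ {z} → Adj w z → Adj d z → z ≡ c
        common wz dz with nbrs-w wz
        ... | #0 = contradiction dz d≁u
        ... | #1 = contradiction dz d≁v
        ... | #2 = refl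
        ... | #3 = contradiction dz adj-irrefl

        c~aside : ∀ {z} → Adj d c → Aside w d z → Adj c z
        c~aside dc (wz , d≁z , z≢d) with nbrs-w wz
        ... | #0 = adj-sym u~c
        ... | #1 = adj-sym v~c
        ... | #2 = contradiction dc d≁z
        ... | #3 = contradiction refl z≢d

        not-two : ¬ TwoCommon w d
        not-two t = c₁≢c₂ (≡-trans (common u~c₁ v~c₁) (sym (common u~c₂ v~c₂)))
          where open TwoCommon t using (c₁≢c₂; u~c₁; v~c₁; u~c₂; v~c₂)

        -- The further neighbours of `w` can only be `u` and `v`, both adjacent to the common
        -- neighbour `c`. These two coincidences lower 14 to 12.
        not-one : ¬ OneCommon w d
        not-one o = few (≤-trans (has-dense wd) (one-common-bound o
          (c-slot ∷ a₁-slot-c (adj aside₁) ∷ a₂-slot-c (adj aside₂) ∷ b₁-slot ∷ b₂-slot ∷ [])))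
          where
          open OneCommon o using (aside₁; aside₂) renaming (c to c′; u~c to w~c′; v~c to d~c′)
          open OneCommonSlots o
          c′≡c : c′ ≡ c
          c′≡c = common w~c′ d~c′
          adj : ∀ {z} → Aside w d z → Adj c′ z
          adj s = subst (λ x → Adj x _) (sym c′≡c) (c~aside (subst (Adj d) c′≡c d~c′) s)

        impossible : ⊥
        impossible = [ not-one , not-two ]′ (classify wd)

      -- Claw-freeness at `u` now forces `c₁` and `c₂` to be adjacent, so they form a `K₄` with `u`
      -- and `v`. No edge of `F` leaves it at `c₁`, which therefore contributes `c₁c₂` alone: 4 + 1
      -- + 1 + 3 + 3 = 12.
      module NoTwoCommon {u v : Vertex} (uv : Has F u v) (t : TwoCommon u v) where
        open TwoCommon t
        open TwoCommonSlots uv t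

        c₁≁b : ¬ Adj c₁ b
        c₁≁b = TwoCommonSlots.c₁≁a (has-sym uv) (TwoCommon.swap-uv t)

        c₂≁a : ¬ Adj c₂ a
        c₂≁a = TwoCommonSlots.c₁≁a uv (TwoCommon.swap-c t)

        c₁~c₂ : Adj c₁ c₂
        c₁~c₂ with claw u~c₁ u~c₂ (proj₁ aside) c₁≢c₂ (separated v~c₁ (proj₁ (proj₂ aside))) (separated v~c₂ (proj₁ (proj₂ aside)))
        ... | inj₁ cc        = cc
        ... | inj₂ (inj₁ ca) = contradiction ca c₁≁a
        ... | inj₂ (inj₂ ca) = contradiction ca c₂≁a

        module Leaving {d : Vertex} (d≢u : d ≢ u) (d≢v : d ≢ v) (d≢c₂ : d ≢ c₂) (c₁d : Has F c₁ d) where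

          d≁u : ¬ Adj d u
          d≁u du with nbrs-u (adj-sym du)
          ... | #0 = d≢v refl
          ... | #1 = adj-irrefl (has⇒adj c₁d)
          ... | #2 = d≢c₂ refl
          ... | #3 = c₁≁a (has⇒adj c₁d)

          d≁v : ¬ Adj d v
          d≁v dv with nbrs-v (adj-sym dv)
          ... | #0 = d≢u refl
          ... | #1 = adj-irrefl (has⇒adj c₁d)
          ... | #2 = d≢c₂ refl
          ... | #3 = c₁≁b (has⇒adj c₁d)

        leaving : ∀ {d} → d ≢ u → d ≢ v → d ≢ c₂ → ¬ Has F c₁ d
        leaving d≢u d≢v d≢c₂ c₁d =
          LeavingK₄.impossible (adj-sym u~c₁) (adj-sym v~c₁) c₁~c₂ u~v u~c₂ v~c₂ d≢c₂ d≢u d≢v d≁u d≁v c₁d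
          where open Leaving d≢u d≢v d≢c₂ c₁d

        c₁-slot′ : Slots (Has F) (u ∷ v ∷ []) c₁ 1
        c₁-slot′ = within (c₂ ∷ []) ≤-refl λ {z} _ z∉ c₁z →
          here (decidable-stable (z ≟ᵛ c₂) λ z≢c₂ → leaving (z∉ ∘ here) (z∉ ∘ there ∘ here) z≢c₂ c₁z)

        impossible : ⊥
        impossible = few (bound (c₁-slot′ ∷ c₂-slot-c₁ c₁~c₂ ∷ a-slot ∷ b-slot ∷ []))

      abstract
        one-common : ∀ {u v} → Has F u v → OneCommon u v
        one-common uv = [ id , ⊥-elim ∘ NoTwoCommon.impossible uv ]′ (classify uv)

      degree≤14 : ∀ {u v} → Has F u v → degree (u , v) F ≤ 14
      degree≤14 uv = one-common-bound (one-common uv) (c-slot ∷ a₁-slot ∷ a₂-slot ∷ b₁-slot ∷ b₂-slot ∷ [])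
        where open OneCommonSlots (one-common uv)

      -- Adjacencies around an edge of `F`

      common-unique : ∀ {u v x y} → Has F u v → Adj u x → Adj v x → Adj u y → Adj v y → x ≡ y
      common-unique uv ux vx uy vy = ≡-trans (common-c ux vx) (sym (common-c uy vy))
        where open OneCommon (one-common uv)

      -- If `c` were adjacent to `a₁`, the edge `uc` would lie in triangles with `v` and with `a₁`,
      -- hence outside `F`. Its absence and the edge `ca₁`, not counted again at `a₁`, leave 12.
      common≁a₁ : ∀ {u v} → Has F u v → (o : OneCommon u v) → ¬ Adj (OneCommon.c o) (OneCommon.a₁ o)
      common≁a₁ {u} {v} uv o ca = few (≤-trans (has-dense uv)
        (degree-bound {triangles = (c , v) ∷ []} near triangle (c-slot ∷ a₁-slot-c ca ∷ a₂-slot ∷ b₁-slot ∷ b₂-slot ∷ [])))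
        where
        open OneCommon o
        open OneCommonSlots o
        triangle : ∀ {x} → Adj u x → Adj v x → (Has F x u → Has ((c , v) ∷ []) x u) × (Has F x v → Has ((c , v) ∷ []) x v)
        triangle ux vx with common-c ux vx
        ... | refl = (λ cu → contradiction (sym (common-unique (has-sym cu) u~v (adj-sym v~c) (proj₁ aside₁) ca)) (proj₂ (proj₂ aside₁)))
                   , (λ _ → inj₁ #0)

      common≁aside : ∀ {u v c a} → Has F u v → Adj u c → Adj v c → Aside u v a → ¬ Adj c a
      common≁aside uv uc vc s ca with one-common uv
      ... | o with OneCommon.common-c o uc vc | OneCommon.aside-∈ o s
      ...   | refl | inj₁ refl = common≁a₁ uv o ca
      ...   | refl | inj₂ refl = common≁a₁ uv (OneCommon.swap-a o) ca

      -- An edge between the two sides is counted at its `a` end and saves one at its `b` end; two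
      -- such edges leave 12.
      module Crossing {u v : Vertex} (uv : Has F u v) (o : OneCommon u v) where
        open OneCommon o
        open OneCommonSlots o

        parallel : Adj a₁ b₁ → ¬ Adj a₂ b₂
        parallel p q = few (≤-trans (has-dense uv) (one-common-bound o
          (c-slot ∷ a₁-slot ∷ a₂-slot ∷ b₁-slot-a₁ p ∷ b₂-slot-a aside₂ #0 q ∷ [])))

        fork-b : Adj a₁ b₁ → ¬ Adj a₁ b₂
        fork-b p q = few (≤-trans (has-dense uv) (one-common-bound o
          (c-slot ∷ a₁-slot ∷ a₂-slot ∷ b₁-slot-a₁ p ∷ b₂-slot-a aside₁ #1 q ∷ [])))

        fork-a : Adj a₁ b₁ → ¬ Adj a₂ b₁
        fork-a p q = few (≤-trans (has-dense uv) (one-common-bound o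
          (c-slot ∷ a₁-slot ∷ a₂-slot ∷ b₁-slot-a₁a₂ p q ∷ b₂-slot ∷ [])))

        crossing₁ : ∀ {a b} → Aside u v a → Aside v u b → Adj a₁ b₁ → Adj a b → a ≡ a₁ × b ≡ b₁
        crossing₁ s t p q with aside-∈ s | OneCommon.aside-∈ swap-uv t
        ... | inj₁ refl | inj₁ refl = refl , refl
        ... | inj₁ refl | inj₂ refl = contradiction q (fork-b p)
        ... | inj₂ refl | inj₁ refl = contradiction q (fork-a p)
        ... | inj₂ refl | inj₂ refl = contradiction q (parallel p)

      crossing-unique : ∀ {u v a a′ b b′} → Has F u v → Aside u v a → Aside u v a′ → Aside v u b → Aside v u b′ →
                        Adj a b → Adj a′ b′ → a′ ≡ a × b′ ≡ b
      crossing-unique uv s s′ t t′ p p′ with one-common uv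
      ... | o with OneCommon.aside-∈ o s | OneCommon.aside-∈ (OneCommon.swap-uv o) t
      ...   | inj₁ refl | inj₁ refl = Crossing.crossing₁ uv o s′ t′ p p′
      ...   | inj₁ refl | inj₂ refl = Crossing.crossing₁ uv (OneCommon.swap-b o) s′ t′ p p′
      ...   | inj₂ refl | inj₁ refl = Crossing.crossing₁ uv (OneCommon.swap-a o) s′ t′ p p′
      ...   | inj₂ refl | inj₂ refl = Crossing.crossing₁ uv (OneCommon.swap-a (OneCommon.swap-b o)) s′ t′ p p′

      -- Cliques of conflicting edges

      -- R is the rest of a clique containing uv and uc. Besides vc it consists of edges at the two further neighbours
      -- of u (kind ap) and edges joining a further neighbour of v to one of c (kind bd), of which there is at most one.
      module SharedVertex {u v c : Vertex} (uv : Has F u v) (uc : Has F u c) (v~c : Adj v c)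
        {R : List Edge} (R! : Unique R) (R⊆F : R ⊆ F)
        (R-uv : ∀ {r} → r ∈ R → Conf (u , v) r) (R-uc : ∀ {r} → r ∈ R → Conf (u , c) r)
        (R-clique : ∀ {r s} → r ∈ R → s ∈ R → r ≢ s → Conf r s) where

        u~v : Adj u v
        u~v = has⇒adj uv

        u~c : Adj u c
        u~c = has⇒adj uc

        -- The further neighbours of `u`, `v` and `c` off the triangle. Those of `u` are taken
        -- relative to `v`; by `A⇒aside-c` they are asides relative to `c` as well.
        IsA IsB IsD : Vertex → Set
        IsA = Aside u v
        IsB = Aside v u
        IsD = Aside c u

        c≁A : ∀ {a} → IsA a → ¬ Adj c a
        c≁A = common≁aside uv u~c v~c

        c≁B : ∀ {b} → IsB b → ¬ Adj c b
        c≁B = common≁aside (has-sym uv) v~c u~c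

        v≁D : ∀ {d} → IsD d → ¬ Adj v d
        v≁D = common≁aside (has-sym uc) (adj-sym v~c) u~v

        v-side : ∀ {b d} → IsB b → IsD d → Aside b d v
        v-side (vb , _) D@(_ , ¬ud , _) = adj-sym vb , v≁D D ∘ adj-sym , separated u~v ¬ud

        c-side : ∀ {b d} → IsB b → IsD d → Aside d b c
        c-side B@(_ , ¬ub , _) (cd , _) = adj-sym cd , c≁B B ∘ adj-sym , separated u~c ¬ub

        A⇒aside-c : ∀ {a} → IsA a → Aside u c a
        A⇒aside-c s@(ua , ¬va , _) = ua , c≁A s , ≢-sym (separated v~c ¬va)

        has-F : ∀ {x y} → Has R x y → Has F x y
        has-F = [ inj₁ ∘ R⊆F , inj₂ ∘ R⊆F ]′

        has-adj : ∀ {x y} → Has R x y → Adj x y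
        has-adj = has⇒adj ∘ has-F

        conflict-uv : ∀ {x y} → Has R x y → Conflict u v x y
        conflict-uv (inj₁ xy∈) = R-uv xy∈
        conflict-uv (inj₂ yx∈) = conf-swapʳ {u , v} (R-uv yx∈)

        conflict-uc : ∀ {x y} → Has R x y → Conflict u c x y
        conflict-uc (inj₁ xy∈) = R-uc xy∈
        conflict-uc (inj₂ yx∈) = conf-swapʳ {u , c} (R-uc yx∈)

        same-or-conflict : ∀ {x y p q} → Has R x y → Has R p q → (x ≡ p × y ≡ q) ⊎ (x ≡ q × y ≡ p) ⊎ Conflict x y p q
        same-or-conflict {x} {y} {p} {q} (inj₁ r) (inj₁ s) with (x , y) ≟ᵉ (p , q)
        ... | yes refl = inj₁ (refl , refl)
        ... | no r≢s   = inj₂ (inj₂ (R-clique r s r≢s))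
        same-or-conflict {x} {y} {p} {q} (inj₁ r) (inj₂ s) with (x , y) ≟ᵉ (q , p)
        ... | yes refl = inj₂ (inj₁ (refl , refl))
        ... | no r≢s   = inj₂ (inj₂ (conf-swapʳ {x , y} (R-clique r s r≢s)))
        same-or-conflict {x} {y} {p} {q} (inj₂ r) (inj₁ s) with (y , x) ≟ᵉ (p , q)
        ... | yes refl = inj₂ (inj₁ (refl , refl))
        ... | no r≢s   = inj₂ (inj₂ (conf-swapˡ {y} {x} {p , q} (R-clique r s r≢s)))
        same-or-conflict {x} {y} {p} {q} (inj₂ r) (inj₂ s) with (y , x) ≟ᵉ (q , p)
        ... | yes refl = inj₁ (refl , refl)
        ... | no r≢s   = inj₂ (inj₂ (conf-swapʳ {x , y} (conf-swapˡ {y} {x} {q , p} (R-clique r s r≢s))))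

        data Kind (x y : Vertex) : Set where
          is-vc : x ≡ v → y ≡ c → Kind x y
          is-ap : IsA x → y ≢ u → y ≢ v → Kind x y
          is-bd : IsB x → IsD y → Kind x y

        -- Sharing `c` with `uc`, the edge `cz` could conflict with it only in a triangle, which
        -- makes `z` a common neighbour of `u` and `c`; the only one is `v`.
        at-c : ∀ {z} → z ≢ u → z ≢ v → ¬ Has R c z
        at-c z≢u z≢v cz with conflict-uc cz
        ... | inj₁ (_ , _ , c≢c , _)                          = c≢c refl
        ... | inj₂ (inj₁ (u≡c , _))                           = adj⇒≢ u~c u≡c
        ... | inj₂ (inj₂ (inj₁ (u≡z , _)))                    = z≢u (sym u≡z)
        ... | inj₂ (inj₂ (inj₂ (inj₁ (_ , _ , uz))))          = z≢v (common-unique uc uz (has-adj cz) u~v (adj-sym v~c))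
        ... | inj₂ (inj₂ (inj₂ (inj₂ (c≡z , _))))             = adj⇒≢ (has-adj cz) c≡z

        -- Since `w` is adjacent to neither `u` nor `c`, the conflict with `uc` forces `z` to be
        -- adjacent to one of them.
        kind-B : ∀ {w z} → Has R w z → IsB w → w ≢ v → z ≢ u → z ≢ v → Kind w z ⊎ Kind z w
        kind-B {w} {z} wz B@(vw , ¬uw , w≢u) w≢v z≢u z≢v with adj? u z
        ... | yes uz = inj₂ (is-ap (uz , ¬vz , z≢v) w≢u w≢v)
          where
          ¬vz : ¬ Adj v z
          ¬vz vz with common-unique uv uz vz u~c v~c
          ... | refl = c≁B B (adj-sym (has-adj wz))
        ... | no ¬uz with conflict-uc wz
        ...   | inj₁ (_ , _ , _ , _ , inj₁ uw)                = contradiction uw ¬uw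
        ...   | inj₁ (_ , _ , _ , _ , inj₂ (inj₁ uz))         = contradiction uz ¬uz
        ...   | inj₁ (_ , _ , _ , _ , inj₂ (inj₂ (inj₁ cw)))  = contradiction cw (c≁B B)
        ...   | inj₁ (_ , _ , _ , _ , inj₂ (inj₂ (inj₂ cz)))  = inj₁ (is-bd B (cz , ¬uz , z≢u))
        ...   | inj₂ (inj₁ (u≡w , _))                         = contradiction (sym u≡w) w≢u
        ...   | inj₂ (inj₂ (inj₁ (u≡z , _)))                  = contradiction (sym u≡z) z≢u
        ...   | inj₂ (inj₂ (inj₂ (inj₁ (refl , _))))          = contradiction u~c ¬uw
        ...   | inj₂ (inj₂ (inj₂ (inj₂ (refl , _))))          = contradiction u~c ¬uz

        kind-touch : ∀ {w z} → Has R w z → Touches u v w z → Kind w z ⊎ Kind z w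
        kind-touch {w} {z} wz (w≢u , w≢v , t) with adj? u w | adj? v w | t
        ... | yes uw | yes vw | inj₁ (_ , z≢u , z≢v) with common-unique uv uw vw u~c v~c
        ...   | refl = contradiction wz (at-c z≢u z≢v)
        kind-touch {w} {z} wz (w≢u , w≢v , t) | yes uw | yes vw | inj₂ (_ , inj₁ refl) with common-unique uv uw vw u~c v~c
        ...   | refl = contradiction (conf-swapʳ {u , c} {c} {u} (conflict-uc wz)) (conf-irrefl {u , c})
        kind-touch {w} {z} wz (w≢u , w≢v , t) | yes uw | yes vw | inj₂ (_ , inj₂ z≡v) =
          inj₂ (is-vc z≡v (common-unique uv uw vw u~c v~c))
        kind-touch {w} {z} wz (w≢u , w≢v , t) | yes uw | no ¬vw | inj₁ (_ , z≢u , z≢v)       = inj₁ (is-ap (uw , ¬vw , w≢v) z≢u z≢v)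
        kind-touch {w} {z} wz (w≢u , w≢v , t) | yes uw | no ¬vw | inj₂ ((_ , vw) , _)        = contradiction vw ¬vw
        kind-touch {w} {z} wz (w≢u , w≢v , t) | no ¬uw | _      | inj₁ (inj₁ uw , _)         = contradiction uw ¬uw
        kind-touch {w} {z} wz (w≢u , w≢v , t) | no ¬uw | _      | inj₁ (inj₂ vw , z≢u , z≢v) = kind-B wz (vw , ¬uw , w≢u) w≢v z≢u z≢v
        kind-touch {w} {z} wz (w≢u , w≢v , t) | no ¬uw | _      | inj₂ ((uw , _) , _)        = contradiction uw ¬uw

        kind : ∀ {x y} → Has R x y → Kind x y ⊎ Kind y x
        kind xy with conflict⇒touches (has-adj xy) (conflict-uv xy)
        ... | inj₁ t = kind-touch xy t
        ... | inj₂ t = [ inj₂ , inj₁ ]′ (kind-touch (has-sym xy) t)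

        record Covered (P : Vertex → Vertex → Set) (k : ℕ) : Set where
          constructor covered
          field
            K     : List Edge
            |K|≤k : length K ≤ k
            cover : ∀ {x y} → Has R x y → P x y → Has K x y

        single : ∀ {P} → (∀ x y → Dec (P x y)) →
                 (∀ {x y p q} → Has R x y → Has R p q → P x y → P p q → p ≡ x × q ≡ y) → Covered P 1
        single P? unique with any? (λ (x , y) → P? x y ⊎-dec P? y x) R
        ... | no ¬any = covered [] z≤n λ where
          (inj₁ xy∈) p → contradiction (lose xy∈ (inj₁ p)) ¬any
          (inj₂ yx∈) p → contradiction (lose yx∈ (inj₂ p)) ¬any
        ... | yes found with find found
        ...   | (x , y) , xy∈ , inj₁ p = covered ((x , y) ∷ []) ≤-refl λ h q →
          let eq₁ , eq₂ = unique (inj₁ xy∈) h p q in inj₁ (here (cong₂ _,_ eq₁ eq₂))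
        ...   | (x , y) , xy∈ , inj₂ p = covered ((y , x) ∷ []) ≤-refl λ h q →
          let eq₁ , eq₂ = unique (inj₂ xy∈) h p q in inj₁ (here (cong₂ _,_ eq₁ eq₂))

        infixr 5 _⊎-covered_
        _⊎-covered_ : ∀ {P Q k l} → Covered P k → Covered Q l → Covered (λ x y → P x y ⊎ Q x y) (k + l)
        covered K K≤ K-cover ⊎-covered covered L L≤ L-cover = covered (K ++ L)
          (≤-trans (≤-reflexive (length-++ K)) (+-mono-≤ K≤ L≤))
          λ h → [ has-++ˡ ∘ K-cover h , has-++ʳ K ∘ L-cover h ]′

        count : ∀ {P k} → Covered P k → (∀ {x y} → Has R x y → Kind x y → P x y) → length R ≤ k
        count {P} (covered K K≤ K-cover) all = ≤-trans (cover-length R! (F-edges ∘ R⊆F) cover) K≤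
          where
          cover : ∀ {x y} → (x , y) ∈ R → Has K x y
          cover xy∈ with kind (inj₁ xy∈)
          ... | inj₁ k = K-cover (inj₁ xy∈) (all (inj₁ xy∈) k)
          ... | inj₂ k = has-sym (K-cover (inj₂ xy∈) (all (inj₂ xy∈) k))

        BD AB AD : Vertex → Vertex → Set
        BD x y = IsB x × IsD y
        AB x y = IsA x × IsB y
        AD x y = IsA x × IsD y

        -- For disjoint `bd` and `b′d′`, the edge `bd` has sides containing `v`, `b′` and `c`, `d′`,
        -- and both `vc` and `b′d′` cross between them, against `crossing-unique`. If the edges
        -- share an end, two adjacent further neighbours create a common neighbour that is adjacent
        -- to a side, against `common≁aside`.
        BD-covered : Covered BD 1
        BD-covered = single (λ x y → aside? v u x ×-dec aside? c u y) unique
          where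
          fork-d : ∀ {b d d′} → Has R b d → Adj b d′ → IsB b → IsD d → IsD d′ → d ≢ d′ → ⊥
          fork-d bd bd′ B D D′ d≢d′ = common≁aside (has-sym (has-F bd)) (asides-adjacent (adj-sym u~c) D D′ d≢d′) bd′
            (c-side B D) (adj-sym (proj₁ D′))
          fork-b : ∀ {b b′ d} → Has R b d → Adj b′ d → IsB b → IsB b′ → IsD d → b ≢ b′ → ⊥
          fork-b bd b′d B B′ D b≢b′ = common≁aside (has-F bd) (asides-adjacent (adj-sym u~v) B B′ b≢b′) (adj-sym b′d)
            (v-side B D) (adj-sym (proj₁ B′))
          unique : ∀ {b d b′ d′} → Has R b d → Has R b′ d′ → BD b d → BD b′ d′ → b′ ≡ b × d′ ≡ d
          unique {b} {d} {b′} {d′} bd b′d′ (B , D) (B′ , D′) with b′ ≟ᵛ b | d′ ≟ᵛ d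
          ... | yes refl | yes refl = refl , refl
          ... | yes refl | no d′≢d  = ⊥-elim (fork-d bd (has-adj b′d′) B D D′ (≢-sym d′≢d))
          ... | no b′≢b  | yes refl = ⊥-elim (fork-b bd (has-adj b′d′) B B′ D (≢-sym b′≢b))
          ... | no b′≢b  | no d′≢d  = contradiction
            (proj₁ (crossing-unique (has-F bd) (v-side B D)
              (asides-adjacent (adj-sym u~v) B B′ (≢-sym b′≢b)
                , (λ db′ → fork-b bd (adj-sym db′) B B′ D (≢-sym b′≢b))
                , separated (proj₁ B′) (v≁D D))
              (c-side B D)
              (asides-adjacent (adj-sym u~c) D D′ (≢-sym d′≢d)
                , (λ bd′ → fork-d bd bd′ B D D′ (≢-sym d′≢d))
                , separated (proj₁ D′) (c≁B B))
              v~c (has-adj b′d′)))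
            (≢-sym (adj⇒≢ (proj₁ B′)))

        AB-covered : Covered AB 1
        AB-covered = single (λ x y → aside? u v x ×-dec aside? v u y)
          λ ab a′b′ (A , B) (A′ , B′) → crossing-unique uv A A′ B B′ (has-adj ab) (has-adj a′b′)

        AD-covered : Covered AD 1
        AD-covered = single (λ x y → aside? u v x ×-dec aside? c u y)
          λ ad a′d′ (A , D) (A′ , D′) → crossing-unique uc (A⇒aside-c A) (A⇒aside-c A′) D D′ (has-adj ad) (has-adj a′d′)

        exact-covered : ∀ p q → Covered (λ x y → x ≡ p × y ≡ q) 1
        exact-covered p q = covered ((p , q) ∷ []) ≤-refl λ { _ (refl , refl) → inj₁ #0 }

        ap-B : ∀ {x y} → Has R x y → IsA x → y ≢ u → Adj v y → IsB y
        ap-B xy A y≢u vy = vy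
          , (λ uy → c≁A A (subst (λ z → Adj z _) (common-unique uv uy vy u~c v~c) (adj-sym (has-adj xy)))) , y≢u

        ap-D : ∀ {y} → y ≢ u → y ≢ v → Adj c y → IsD y
        ap-D y≢u y≢v cy = cy , (λ uy → y≢v (common-unique uc uy cy u~v (adj-sym v~c))) , y≢u

        -- To conflict with `vc`, an edge at a further neighbour of `u` must end at a further
        -- neighbour of `v` or of `c`. Together with `vc` and `bd` this makes 1 + 1 + 1 + 1.
        with-vc : Has R v c → length R ≤ 4
        with-vc vc∈ = count (exact-covered v c ⊎-covered BD-covered ⊎-covered AB-covered ⊎-covered AD-covered) sort
          where
          ap-sort : ∀ {x y} → Has R x y → IsA x → y ≢ u → y ≢ v → AB x y ⊎ AD x y
          ap-sort xy A@(_ , ¬vx , x≢v) y≢u y≢v with same-or-conflict vc∈ xy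
          ... | inj₁ (v≡x , _)                                         = contradiction (sym v≡x) x≢v
          ... | inj₂ (inj₁ (v≡y , _))                                  = contradiction (sym v≡y) y≢v
          ... | inj₂ (inj₂ (inj₁ (_ , _ , _ , _ , inj₁ vx)))           = contradiction vx ¬vx
          ... | inj₂ (inj₂ (inj₁ (_ , _ , _ , _ , inj₂ (inj₁ vy))))    = inj₁ (A , ap-B xy A y≢u vy)
          ... | inj₂ (inj₂ (inj₁ (_ , _ , _ , _ , inj₂ (inj₂ (inj₁ cx))))) = contradiction cx (c≁A A)
          ... | inj₂ (inj₂ (inj₁ (_ , _ , _ , _ , inj₂ (inj₂ (inj₂ cy))))) = inj₂ (A , ap-D y≢u y≢v cy)
          ... | inj₂ (inj₂ (inj₂ (inj₁ (v≡x , _))))                    = contradiction (sym v≡x) x≢v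
          ... | inj₂ (inj₂ (inj₂ (inj₂ (inj₁ (v≡y , _)))))             = contradiction (sym v≡y) y≢v
          ... | inj₂ (inj₂ (inj₂ (inj₂ (inj₂ (inj₁ (refl , _))))))     = contradiction v~c ¬vx
          ... | inj₂ (inj₂ (inj₂ (inj₂ (inj₂ (inj₂ (refl , _))))))     = contradiction (adj-sym (has-adj xy)) (c≁A A)
          sort : ∀ {x y} → Has R x y → Kind x y → (x ≡ v × y ≡ c) ⊎ BD x y ⊎ AB x y ⊎ AD x y
          sort _  (is-vc p q)       = inj₁ (p , q)
          sort _  (is-bd B D)       = inj₂ (inj₁ (B , D))
          sort xy (is-ap A y≢u y≢v) = inj₂ (inj₂ (ap-sort xy A y≢u y≢v))

        -- Otherwise `a′` is a common neighbour of `a` and `y`, and it is adjacent to `u`, an aside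
        -- of `a`; `common≁aside` for the edge `ay` forbids this.
        A-fork : ∀ {a a′ y} → Has R a y → IsA a → IsA a′ → ¬ Adj u y → y ≢ u → Adj a a′ → ¬ Adj y a′
        A-fork ay (ua , _) (ua′ , _) ¬uy y≢u aa′ ya′ =
          common≁aside (has-F ay) aa′ ya′ (adj-sym ua , ¬uy ∘ adj-sym , ≢-sym y≢u) (adj-sym ua′)

        A-two : ∀ {a a′ x} → IsA a → IsA a′ → a ≢ a′ → IsA x → x ≡ a ⊎ x ≡ a′
        A-two A A′ a≢a′ X with aside-∈ A | aside-∈ A′ | aside-∈ X
          where open OneCommon (one-common uv)
        ... | inj₁ refl | inj₁ refl | _         = contradiction refl a≢a′
        ... | inj₂ refl | inj₂ refl | _         = contradiction refl a≢a′
        ... | inj₁ refl | inj₂ refl | inj₁ refl = inj₁ refl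
        ... | inj₁ refl | inj₂ refl | inj₂ refl = inj₂ refl
        ... | inj₂ refl | inj₁ refl | inj₁ refl = inj₂ refl
        ... | inj₂ refl | inj₁ refl | inj₂ refl = inj₁ refl

        -- Another edge at `a` shares an end with `aa′`, so the conflict needs a triangle, which
        -- `A-fork` denies. The edge `aa′` is listed in both orientations, so the bound comes out as
        -- 3.
        with-AA : ∀ {a a′} → ¬ Has R v c → Has R a a′ → IsA a → IsA a′ → length R ≤ 4
        with-AA {a} {a′} ¬vc aa′ A A′ =
          ≤-trans (count (exact-covered a a′ ⊎-covered exact-covered a′ a ⊎-covered BD-covered) sort) (toWitness {a? = 3 ≤? 4} _)
          where
          a≢a′ : a ≢ a′
          a≢a′ = adj⇒≢ (has-adj aa′)
          outside : ∀ {a a′ y} → Has R a a′ → IsA a → IsA a′ → Has R a y → y ≢ u → ¬ Adj u y → ⊥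
          outside aa′ A A′ ay y≢u ¬uy with same-or-conflict ay aa′
          ... | inj₁ (_ , refl)                                    = ¬uy (proj₁ A′)
          ... | inj₂ (inj₁ (a≡a′ , _))                             = adj⇒≢ (has-adj aa′) a≡a′
          ... | inj₂ (inj₂ (inj₁ (a≢a , _)))                       = a≢a refl
          ... | inj₂ (inj₂ (inj₂ (inj₁ (_ , _ , ya′))))            = A-fork ay A A′ ¬uy y≢u (has-adj aa′) ya′
          ... | inj₂ (inj₂ (inj₂ (inj₂ (inj₁ (a≡a′ , _)))))        = adj⇒≢ (has-adj aa′) a≡a′
          ... | inj₂ (inj₂ (inj₂ (inj₂ (inj₂ (inj₁ (refl , _)))))) = ¬uy (proj₁ A)
          ... | inj₂ (inj₂ (inj₂ (inj₂ (inj₂ (inj₂ (refl , _)))))) = ¬uy (proj₁ A′)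
          ap-inside : ∀ {x y} → Has R x y → IsA x → IsA y → (x ≡ a × y ≡ a′) ⊎ (x ≡ a′ × y ≡ a)
          ap-inside xy X Y with A-two A A′ a≢a′ X | A-two A A′ a≢a′ Y
          ... | inj₁ refl | inj₁ refl = contradiction (has-adj xy) adj-irrefl
          ... | inj₁ p    | inj₂ q    = inj₁ (p , q)
          ... | inj₂ p    | inj₁ q    = inj₂ (p , q)
          ... | inj₂ refl | inj₂ refl = contradiction (has-adj xy) adj-irrefl
          ap-sort : ∀ {x y} → Has R x y → IsA x → y ≢ u → y ≢ v → (x ≡ a × y ≡ a′) ⊎ (x ≡ a′ × y ≡ a)
          ap-sort {x} {y} xy X y≢u y≢v with adj? u y
          ... | yes uy = ap-inside xy X (uy , (λ vy → proj₁ (proj₂ (ap-B xy X y≢u vy)) uy) , y≢v)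
          ... | no ¬uy with A-two A A′ a≢a′ X
          ...   | inj₁ refl = ⊥-elim (outside aa′ A A′ xy y≢u ¬uy)
          ...   | inj₂ refl = ⊥-elim (outside (has-sym aa′) A′ A xy y≢u ¬uy)
          sort : ∀ {x y} → Has R x y → Kind x y → (x ≡ a × y ≡ a′) ⊎ (x ≡ a′ × y ≡ a) ⊎ BD x y
          sort xy (is-vc refl refl)  = contradiction xy ¬vc
          sort _  (is-bd B D)        = inj₂ (inj₂ (B , D))
          sort xy (is-ap A y≢u y≢v)  = [ inj₁ , inj₂ ∘ inj₁ ]′ (ap-sort xy A y≢u y≢v)

        module Remaining (¬vc : ¬ Has R v c) (¬AA : ∀ {x y} → Has R x y → IsA x → ¬ IsA y) where

          ap-outer : ∀ {x y} → Has R x y → IsA x → y ≢ u → y ≢ v → ¬ Adj u y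
          ap-outer xy A y≢u y≢v uy = ¬AA xy A (uy , (λ vy → proj₁ (proj₂ (ap-B xy A y≢u vy)) uy) , y≢v)

          AA-excluded : ∀ {a a′} → IsA a → IsA a′ → ¬ Has R a a′
          AA-excluded A A′ aa′ = ¬AA aa′ A A′

          module _ (o : OneCommon u v) where
            open OneCommon o using (a₁; a₂; aside₁; aside₂; a₁~a₂; aside-∈)

            a₁-slot : Slots (Has R) (u ∷ []) a₁ 2
            a₁-slot = slots (u ∷ a₂ ∷ []) ((adj⇒≢ (proj₁ aside₂) ∷ []) ∷ [] ∷ [])
              ((adj-sym (proj₁ aside₁) , inj₁ #0) ∷ (a₁~a₂ , inj₂ (AA-excluded aside₁ aside₂)) ∷ [])

            a₂-slot : Slots (Has R) (a₁ ∷ u ∷ []) a₂ 2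
            a₂-slot = slots (u ∷ a₁ ∷ []) ((adj⇒≢ (proj₁ aside₁) ∷ []) ∷ [] ∷ [])
              ((adj-sym (proj₁ aside₂) , inj₁ #1) ∷ (adj-sym a₁~a₂ , inj₁ #0) ∷ [])

            incident : ∀ {ws m} → (∀ {w} → w ∈ ws → Adj u w) → Incidences (Has R) (u ∷ []) ws m → Covered (λ x y → x ∈ ws × y ≢ u) m
            incident uws i with incidences-cover has-sym i
            ... | K , K≤ , K-cover = covered K K≤ λ xy (x∈ , y≢u) →
              K-cover x∈ (λ { #0 → adj-irrefl (uws x∈) }) (λ { (here p) → y≢u p }) (has-adj xy) xy

            A-covered : Covered (λ x y → x ∈ a₁ ∷ a₂ ∷ [] × y ≢ u) 4
            A-covered = incident (λ { #0 → proj₁ aside₁ ; #1 → proj₁ aside₂ }) (a₁-slot ∷ a₂-slot ∷ [])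

            a₁-covered : Covered (λ x y → x ∈ a₁ ∷ [] × y ≢ u) 2
            a₁-covered = incident (λ { #0 → proj₁ aside₁ }) (a₁-slot ∷ [])

            -- Now every edge of `R` is at `a₁` or `a₂`, and each of these has two places besides
            -- `u` and the other one.
            without-BD : (∀ {x y} → Has R x y → ¬ BD x y) → length R ≤ 4
            without-BD ¬BD = count A-covered sort
              where
              sort : ∀ {x y} → Has R x y → Kind x y → x ∈ a₁ ∷ a₂ ∷ [] × y ≢ u
              sort xy (is-vc refl refl) = contradiction xy ¬vc
              sort xy (is-bd B D)       = contradiction (B , D) (¬BD xy)
              sort xy (is-ap A y≢u _)   = [ here , there ∘ here ]′ (aside-∈ A) , y≢u

          module WithBD {b d : Vertex} (bd∈ : Has R b d) (B : IsB b) (D : IsD d) where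

            b~d : Adj b d
            b~d = has-adj bd∈

            -- What a conflict with `bd` means for an edge `xy` at a further neighbour `x` of `u`.
            -- If `y` is adjacent to only one of `b` and `d`, claw-freeness there makes it adjacent
            -- to `v` or to `c` respectively.
            Meets : Vertex → Vertex → Set
            Meets x y = Adj b x ⊎ Adj d x ⊎ (Adj b y × Adj d y) ⊎ IsB y ⊎ IsD y

            near-b : ∀ {x y} → Has R x y → IsA x → y ≢ u → y ≢ v → y ≢ d → Adj b y → Meets x y
            near-b {x} {y} xy A y≢u y≢v y≢d by with adj? d y
            ... | yes dy = inj₂ (inj₂ (inj₁ (by , dy)))
            ... | no ¬dy = inj₂ (inj₂ (inj₂ (inj₁ (ap-B xy A y≢u (asides-adjacent b~d (v-side B D) (by , ¬dy , y≢d) (≢-sym y≢v))))))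

            near-d : ∀ {x y} → Has R x y → IsA x → y ≢ u → y ≢ v → y ≢ b → Adj d y → Meets x y
            near-d {x} {y} xy A y≢u y≢v y≢b dy with adj? b y
            ... | yes by = inj₂ (inj₂ (inj₁ (by , dy)))
            ... | no ¬by = inj₂ (inj₂ (inj₂ (inj₂ (ap-D y≢u y≢v (asides-adjacent (adj-sym b~d) (c-side B D) (dy , ¬by , y≢b)
                             λ { refl → c≁A A (adj-sym (has-adj xy)) })))))

            meets : ∀ {x y} → Has R x y → IsA x → y ≢ u → y ≢ v → Meets x y
            meets {x} {y} xy A@(_ , ¬vx , _) y≢u y≢v with same-or-conflict bd∈ xy
            ... | inj₁ (refl , _)                                            = contradiction (proj₁ B) ¬vx
            ... | inj₂ (inj₁ (_ , refl))                                     = contradiction (proj₁ D) (c≁A A)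
            ... | inj₂ (inj₂ (inj₁ (_ , _ , _ , _ , inj₁ bx)))               = inj₁ bx
            ... | inj₂ (inj₂ (inj₁ (_ , _ , _ , d≢y , inj₂ (inj₁ by))))      = near-b xy A y≢u y≢v (≢-sym d≢y) by
            ... | inj₂ (inj₂ (inj₁ (_ , _ , _ , _ , inj₂ (inj₂ (inj₁ dx))))) = inj₂ (inj₁ dx)
            ... | inj₂ (inj₂ (inj₁ (_ , b≢y , _ , _ , inj₂ (inj₂ (inj₂ dy))))) = near-d xy A y≢u y≢v (≢-sym b≢y) dy
            ... | inj₂ (inj₂ (inj₂ (inj₁ (refl , _))))                       = contradiction (proj₁ B) ¬vx
            ... | inj₂ (inj₂ (inj₂ (inj₂ (inj₁ (_ , _ , dx)))))              = inj₂ (inj₁ dx)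
            ... | inj₂ (inj₂ (inj₂ (inj₂ (inj₂ (inj₁ (refl , _))))))         = contradiction (proj₁ D) (c≁A A)
            ... | inj₂ (inj₂ (inj₂ (inj₂ (inj₂ (inj₂ (_ , _ , bx))))))       = inj₁ bx

            AX : Vertex → Vertex → Set
            AX x y = IsA x × y ≢ u × y ≢ v × Adj b y × Adj d y

            -- The end `y` is the only common neighbour of `b` and `d`, and by `A-fork` it is
            -- adjacent to only one further neighbour of `u`.
            AX-covered : Covered AX 1
            AX-covered = single
              (λ x y → aside? u v x ×-dec ¬? (y ≟ᵛ u) ×-dec ¬? (y ≟ᵛ v) ×-dec adj? b y ×-dec adj? d y) unique
              where
              unique : ∀ {x y p q} → Has R x y → Has R p q → AX x y → AX p q → p ≡ x × q ≡ y
              unique {x} {y} {p} {q} xy pq (X , y≢u , y≢v , by , dy) (P , _ , _ , bq , dq)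
                with common-unique (has-F bd∈) bq dq by dy | p ≟ᵛ x
              ... | refl | yes p≡x = p≡x , refl
              ... | refl | no p≢x  = contradiction (adj-sym (has-adj pq))
                (A-fork xy X P (ap-outer xy X y≢u y≢v) y≢u (asides-adjacent u~v X P (≢-sym p≢x)))

            apart : (∀ {x} → IsA x → ¬ (Adj b x ⊎ Adj d x)) → length R ≤ 4
            apart ¬near = count (BD-covered ⊎-covered AB-covered ⊎-covered AD-covered ⊎-covered AX-covered) sort
              where
              sort : ∀ {x y} → Has R x y → Kind x y → BD x y ⊎ AB x y ⊎ AD x y ⊎ AX x y
              sort xy (is-vc refl refl)  = contradiction xy ¬vc
              sort xy (is-bd B D)        = inj₁ (B , D)
              sort xy (is-ap A y≢u y≢v) with meets xy A y≢u y≢v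
              ... | inj₁ bx                            = contradiction (inj₁ bx) (¬near A)
              ... | inj₂ (inj₁ dx)                     = contradiction (inj₂ dx) (¬near A)
              ... | inj₂ (inj₂ (inj₁ (by , dy)))       = inj₂ (inj₂ (inj₂ (A , y≢u , y≢v , by , dy)))
              ... | inj₂ (inj₂ (inj₂ (inj₁ B′)))       = inj₂ (inj₁ (A , B′))
              ... | inj₂ (inj₂ (inj₂ (inj₂ D′)))       = inj₂ (inj₂ (inj₁ (A , D′)))

            -- Were `a` adjacent to `b` only, claw-freeness at `b` would make it adjacent to `v`;
            -- were it adjacent to `d` only, to `c`. Neither is allowed.
            common-neighbour : ∀ {a} → IsA a → Adj b a ⊎ Adj d a → Adj b a × Adj d a
            common-neighbour {a} A@(_ , ¬va , a≢v) (inj₁ ba) = ba , decidable-stable (adj? d a) λ ¬da →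
              ¬va (asides-adjacent b~d (v-side B D) (ba , ¬da , separated′) (≢-sym a≢v))
              where
              separated′ : a ≢ d
              separated′ refl = c≁A A (proj₁ D)
            common-neighbour {a} A (inj₂ da) = decidable-stable (adj? b a) (λ ¬ba →
              c≁A A (asides-adjacent (adj-sym b~d) (c-side B D) (da , ¬ba , (λ { refl → proj₁ (proj₂ A) (proj₁ B) }))
                λ { refl → proj₁ (proj₂ A) v~c })) , da

            -- Now `a₁b` is the only crossing for `uv` and `a₁d` the only one for `uc`, so every
            -- edge besides `bd` starts at `a₁`, which has two places besides `u` and `a₂`: 1 + 2.
            joined : (o : OneCommon u v) → Adj b (OneCommon.a₁ o) ⊎ Adj d (OneCommon.a₁ o) → length R ≤ 4
            joined o near = ≤-trans (count (BD-covered ⊎-covered a₁-covered o) sort) (toWitness {a? = 3 ≤? 4} _)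
              where
              open OneCommon o using (a₁; aside₁)
              b~a₁ : Adj b a₁
              b~a₁ = proj₁ (common-neighbour aside₁ near)
              d~a₁ : Adj d a₁
              d~a₁ = proj₂ (common-neighbour aside₁ near)
              at-a₁-uv : ∀ {x y} → IsA x → IsB y → Adj x y → x ≡ a₁
              at-a₁-uv A B′ xy = proj₁ (crossing-unique uv aside₁ A B B′ (adj-sym b~a₁) xy)
              at-a₁-uc : ∀ {x y} → IsA x → IsD y → Adj x y → x ≡ a₁
              at-a₁-uc A D′ xy = proj₁ (crossing-unique uc (A⇒aside-c aside₁) (A⇒aside-c A) D D′ (adj-sym d~a₁) xy)
              at-a₁ : ∀ {x y} → Has R x y → IsA x → Meets x y → x ≡ a₁
              at-a₁ xy A (inj₁ bx)                      = at-a₁-uv A B (adj-sym bx)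
              at-a₁ xy A (inj₂ (inj₁ dx))               = at-a₁-uc A D (adj-sym dx)
              at-a₁ xy A (inj₂ (inj₂ (inj₁ (by , dy)))) with common-unique (has-F bd∈) by dy b~a₁ d~a₁
              ... | refl = contradiction aside₁ (¬AA xy A)
              at-a₁ xy A (inj₂ (inj₂ (inj₂ (inj₁ B′)))) = at-a₁-uv A B′ (has-adj xy)
              at-a₁ xy A (inj₂ (inj₂ (inj₂ (inj₂ D′)))) = at-a₁-uc A D′ (has-adj xy)
              sort : ∀ {x y} → Has R x y → Kind x y → BD x y ⊎ (x ∈ a₁ ∷ [] × y ≢ u)
              sort xy (is-vc refl refl)  = contradiction xy ¬vc
              sort xy (is-bd B D)        = inj₁ (B , D)
              sort xy (is-ap A y≢u y≢v)  = inj₂ (here (at-a₁ xy A (meets xy A y≢u y≢v)) , y≢u)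

            with-BD : OneCommon u v → length R ≤ 4
            with-BD o with adj? b a₁ ⊎-dec adj? d a₁ | adj? b a₂ ⊎-dec adj? d a₂
              where open OneCommon o
            ... | yes near | _        = joined o near
            ... | no _     | yes near = joined (OneCommon.swap-a o) near
            ... | no ¬near₁ | no ¬near₂ = apart λ A → [ (λ { refl → ¬near₁ }) , (λ { refl → ¬near₂ }) ]′ (OneCommon.aside-∈ o A)

        |R|≤4 : length R ≤ 4
        |R|≤4 with has? R v c
        ... | yes vc∈ = with-vc vc∈
        ... | no ¬vc with any? (λ (x , y) → aside? u v x ×-dec aside? u v y) R
        ...   | yes aa with find aa
        ...     | _ , xy∈ , X , Y = with-AA ¬vc (inj₁ xy∈) X Y
        |R|≤4 | no ¬vc | no ¬aa with any? (λ (x , y) → (aside? v u x ×-dec aside? c u y) ⊎-dec (aside? v u y ×-dec aside? c u x)) R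
        ... | no ¬bd = Remaining.without-BD ¬vc
              (λ { (inj₁ xy∈) X Y → ¬aa (lose xy∈ (X , Y)) ; (inj₂ yx∈) X Y → ¬aa (lose yx∈ (Y , X)) }) (one-common uv)
              λ { (inj₁ xy∈) p → ¬bd (lose xy∈ (inj₁ p)) ; (inj₂ yx∈) p → ¬bd (lose yx∈ (inj₂ p)) }
        ... | yes found with find found
        ...   | _ , xy∈ , inj₁ (B , D) = Remaining.WithBD.with-BD ¬vc
              (λ { (inj₁ xy∈) X Y → ¬aa (lose xy∈ (X , Y)) ; (inj₂ yx∈) X Y → ¬aa (lose yx∈ (Y , X)) }) (inj₁ xy∈) B D (one-common uv)
        ...   | _ , xy∈ , inj₂ (B , D) = Remaining.WithBD.with-BD ¬vc
              (λ { (inj₁ xy∈) X Y → ¬aa (lose xy∈ (X , Y)) ; (inj₂ yx∈) X Y → ¬aa (lose yx∈ (Y , X)) }) (inj₂ xy∈) B D (one-common uv)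

      -- Cliques with and without two edges sharing an endpoint

      Meet : Edge → Edge → Set
      Meet (x , y) (p , q) = x ≡ p ⊎ x ≡ q ⊎ y ≡ p ⊎ y ≡ q

      meet? : B.Decidable Meet
      meet? (x , y) (p , q) = x ≟ᵛ p ⊎-dec x ≟ᵛ q ⊎-dec y ≟ᵛ p ⊎-dec y ≟ᵛ q

      End : Vertex → Edge → Set
      End w (x , y) = w ≡ x ⊎ w ≡ y

      ends⇒meet : ∀ {w e f} → End w e → End w f → Meet e f
      ends⇒meet (inj₁ refl) (inj₁ p) = inj₁ p
      ends⇒meet (inj₁ refl) (inj₂ p) = inj₂ (inj₁ p)
      ends⇒meet (inj₂ refl) (inj₁ p) = inj₂ (inj₂ (inj₁ p))
      ends⇒meet (inj₂ refl) (inj₂ p) = inj₂ (inj₂ (inj₂ p))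

      -- Ends chosen on pairwise disjoint edges are distinct, so there are at most as many edges as
      -- vertices in `N`.
      transversal : ∀ {N} L → AllPairs (λ e f → ¬ Meet e f) L → (∀ {r} → r ∈ L → ∃ λ w → End w r × w ∈ N) →
        ∃ λ W → Unique W × length W ≡ length L × W ⊆ N × (∀ {w} → w ∈ W → ∃ λ r → r ∈ L × End w r)
      transversal []      _            _    = [] , [] , refl , (λ ()) , λ ()
      transversal (r ∷ L) (r∥L ∷ L∥) hits with hits (here refl) | transversal L L∥ (hits ∘ there)
      ... | w , w-end , w∈N | W , W! , |W| , W⊆N , W-ends = w ∷ W
        , All.tabulate (λ v∈W w≡v → let s , s∈ , v-end = W-ends v∈W in
            All.lookup r∥L s∈ (ends⇒meet {w} {r} {s} w-end (subst (λ z → End z s) (sym w≡v) v-end))) ∷ W!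
        , cong suc |W|
        , (λ { (here refl) → w∈N ; (there q) → W⊆N q })
        , λ { (here refl) → r , here refl , w-end ; (there q) → let s , s∈ , e = W-ends q in s , there s∈ , e }

      module Clique {Q : List Edge} (Q-clique : AllPairs Conf Q) (Q⊆F : Q ⊆ F) where

        Q! : Unique Q
        Q! = AllPairs.map (λ {e} ef e≡f → conf-irrefl {e} (subst (Conf e) (sym e≡f) ef)) Q-clique

        pairwise : ∀ {e f} → e ∈ Q → f ∈ Q → e ≢ f → Conf e f
        pairwise {e} {f} e∈ f∈ e≢f with ∈-AllPairs₂ Q-clique e∈ f∈
        ... | inj₁ e≡f       = contradiction e≡f e≢f
        ... | inj₂ (inj₁ ef) = ef
        ... | inj₂ (inj₂ fe) = conf-sym {f} {e} fe

        -- Conflicting edges that share an endpoint lie in a triangle, so `SharedVertex` bounds the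
        -- rest of the clique, giving 2 + 4. The primed variants turn an edge so that it starts at
        -- the shared vertex.
        meeting : ∀ {e f} → e ∈ Q → f ∈ Q → e ≢ f → Meet e f → length Q ≤ 6
        meeting {e@(x , y)} {f@(p , q)} e∈ f∈ e≢f m = ≤-trans (Unique-⊆⇒length≤ Q! ⊆-without)
          (s≤s (≤-trans (Unique-⊆⇒length≤ (without! e Q!) ⊆-without) (s≤s (|R|≤4 (pairwise e∈ f∈ e≢f)))))
          where
          R = without f (without e Q)
          R⊆Q : R ⊆ Q
          R⊆Q = without-⊆ {e} ∘ without-⊆ {f}
          R-e : ∀ {r} → r ∈ R → Conf e r
          R-e r∈ = pairwise e∈ (R⊆Q r∈) (proj₂ (∈-filter⁻ (λ r → ¬? (e ≟ᵉ r)) {xs = Q} (without-⊆ {f} r∈)))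
          R-f : ∀ {r} → r ∈ R → Conf f r
          R-f r∈ = pairwise f∈ (R⊆Q r∈) (proj₂ (∈-filter⁻ (λ r → ¬? (f ≟ᵉ r)) {xs = without e Q} r∈))
          R-e′ : ∀ {r} → r ∈ R → Conf (y , x) r
          R-e′ {r} r∈ = conf-swapˡ {x} {y} {r} (R-e r∈)
          R-f′ : ∀ {r} → r ∈ R → Conf (q , p) r
          R-f′ {r} r∈ = conf-swapˡ {p} {q} {r} (R-f r∈)
          apply : ∀ {u v c} → Has F u v → Has F u c → Adj v c →
                  (∀ {r} → r ∈ R → Conf (u , v) r) → (∀ {r} → r ∈ R → Conf (u , c) r) → length R ≤ 4
          apply uv uc v~c R-uv R-uc = SharedVertex.|R|≤4 uv uc v~c (without! f (without! e Q!)) (Q⊆F ∘ R⊆Q) R-uv R-uc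
            λ r∈ s∈ → pairwise (R⊆Q r∈) (R⊆Q s∈)
          |R|≤4 : Conf e f → length R ≤ 4
          |R|≤4 (inj₁ (x≢p , x≢q , y≢p , y≢q , _)) = contradiction m λ where
            (inj₁ x≡p)               → x≢p x≡p
            (inj₂ (inj₁ x≡q))        → x≢q x≡q
            (inj₂ (inj₂ (inj₁ y≡p))) → y≢p y≡p
            (inj₂ (inj₂ (inj₂ y≡q))) → y≢q y≡q
          |R|≤4 (inj₂ (inj₁ (refl , _ , yq)))               = apply (inj₁ (Q⊆F e∈)) (inj₁ (Q⊆F f∈)) yq R-e R-f
          |R|≤4 (inj₂ (inj₂ (inj₁ (refl , _ , yp))))        = apply (inj₁ (Q⊆F e∈)) (inj₂ (Q⊆F f∈)) yp R-e R-f′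
          |R|≤4 (inj₂ (inj₂ (inj₂ (inj₁ (refl , _ , xq))))) = apply (inj₂ (Q⊆F e∈)) (inj₁ (Q⊆F f∈)) xq R-e′ R-f
          |R|≤4 (inj₂ (inj₂ (inj₂ (inj₂ (refl , _ , xp))))) = apply (inj₂ (Q⊆F e∈)) (inj₂ (Q⊆F f∈)) xp R-e′ R-f′

      -- In a clique of pairwise disjoint edges, the others meet the five further neighbours of the ends of any one of them.
      disjoint-clique : ∀ {Q} → AllPairs Conf Q → Q ⊆ F → AllPairs (λ e f → ¬ Meet e f) Q → length Q ≤ 6
      disjoint-clique {[]} _ _ _ = z≤n
      disjoint-clique {(u , v) ∷ Q} (uv-Q ∷ _) Q⊆F (_ ∷ Q∥)
        with transversal {c ∷ a₁ ∷ a₂ ∷ b₁ ∷ b₂ ∷ []} Q Q∥ hits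
        where
        open OneCommon (one-common (inj₁ (Q⊆F (here refl))))
        hits : ∀ {r} → r ∈ Q → ∃ λ w → End w r × w ∈ c ∷ a₁ ∷ a₂ ∷ b₁ ∷ b₂ ∷ []
        hits {x , y} r∈ with conflict⇒touches (proj₂ (F-edges (Q⊆F (there r∈)))) (All.lookup uv-Q r∈)
        ... | inj₁ (x≢u , x≢v , inj₁ (t , _))        = x , inj₁ refl , near x≢u x≢v t
        ... | inj₁ (x≢u , x≢v , inj₂ ((ux , _) , _)) = x , inj₁ refl , near x≢u x≢v (inj₁ ux)
        ... | inj₂ (y≢u , y≢v , inj₁ (t , _))        = y , inj₂ refl , near y≢u y≢v t
        ... | inj₂ (y≢u , y≢v , inj₂ ((uy , _) , _)) = y , inj₂ refl , near y≢u y≢v (inj₁ uy)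
      ... | W , W! , |W| , W⊆ , _ = s≤s (subst (_≤ 5) |W| (Unique-⊆⇒length≤ W! W⊆))

      cliques≤6 : CliquesAtMost 6 F
      cliques≤6 {Q} Q-clique Q⊆F with any? (λ e → any? (λ f → ¬? (e ≟ᵉ f) ×-dec meet? e f) Q) Q
      ... | yes p with find p
      ...   | e , e∈ , q with find q
      ...     | f , f∈ , e≢f , m = Clique.meeting Q-clique Q⊆F e∈ f∈ e≢f m
      cliques≤6 {Q} Q-clique Q⊆F | no ¬p = disjoint-clique Q-clique Q⊆F
        (pairwise⇒AllPairs (Clique.Q! Q-clique Q⊆F) λ e∈ f∈ e≢f m → ¬p (lose e∈ (lose f∈ (e≢f , m))))

    -- Induction on the edge list and transfer to `G`

    colourable : (F : List Edge) → Acc _<_ (length F) → Unique F → Oriented F → Colourable 13 F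
    colourable F (acc smaller) F! F-edges with any? (λ e → degree e F <? 13) F
    ... | yes low with find low
    ...   | e , e∈ , d<13 = degenerate-step F! d<13
      (colourable (without e F) (smaller (without-< e∈)) (without! e F!) (F-edges ∘ without-⊆ {e}))
    colourable F _ F! F-edges | no ¬low =
      catlin {6} {7} (toWitness {a? = 3 ≤? 6} _) (toWitness {a? = 6 ≤? 7} _) F! (λ e∈ → degree≤14 (inj₁ e∈)) cliques≤6
      where open Core F! F-edges (λ e∈ → ≮⇒≥ λ d<13 → ¬low (lose e∈ d<13))

  orient-cases : ∀ x y → orient (x , y) ≡ (x , y) ⊎ orient (x , y) ≡ (y , x)
  orient-cases x y with x Fin.<? y
  ... | yes _ = inj₁ refl
  ... | no  _ = inj₂ refl

  orient-comm : ∀ {x y} → x ≢ y → orient (x , y) ≡ orient (y , x)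
  orient-comm {x} {y} x≢y with Fin.<-cmp x y
  ... | tri< x<y _ _   = ≡-trans (orient-< x<y) (sym (orient-> x<y))
  ... | tri≈ _ x≡y _   = contradiction x≡y x≢y
  ... | tri> _ _ y<x   = ≡-trans (orient-> y<x) (sym (orient-< y<x))

  conf-orientʳ : ∀ {e c d} → Conf e (c , d) → Conf e (orient (c , d))
  conf-orientʳ {e} {c} {d} k with orient-cases c d
  ... | inj₁ eq = subst (Conf e) (sym eq) k
  ... | inj₂ eq = subst (Conf e) (sym eq) (conf-swapʳ {e} k)

  conf-orient : ∀ {a b c d} → Conf (a , b) (c , d) → Conf (orient (a , b)) (orient (c , d))
  conf-orient {a} {b} {c} {d} k =
    conf-sym {orient (c , d)} {orient (a , b)} (conf-orientʳ {orient (c , d)}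
      (conf-sym {a , b} {orient (c , d)} (conf-orientʳ {a , b} k)))

  oriented-edge? : Decidable (λ ((x , y) : Edge) → x <ᶠ y × Adj x y)
  oriented-edge? (x , y) = (x Fin.<? y) ×-dec adj? x y

  edges : List Edge
  edges = filter oriented-edge? (cartesianProduct (allFin n) (allFin n))

  edges! : Unique edges
  edges! = Unique.filter⁺ oriented-edge? (Unique.cartesianProduct⁺ (Unique.allFin⁺ n) (Unique.allFin⁺ n))

  edges-oriented : Oriented edges
  edges-oriented = proj₂ ∘ ∈-filter⁻ oriented-edge? {xs = cartesianProduct (allFin n) (allFin n)}

  orient∈edges : ∀ {x y} → Adj x y → orient (x , y) ∈ edges
  orient∈edges {x} {y} xy with Fin.<-cmp x y
  ... | tri< x<y _ _    = subst (_∈ edges) (sym (orient-< x<y))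
    (∈-filter⁺ oriented-edge? (∈-cartesianProduct⁺ (∈-allFin x) (∈-allFin y)) (x<y , xy))
  ... | tri≈ _ x≡y _    = contradiction x≡y (adj⇒≢ xy)
  ... | tri> _ _ y<x    = subst (_∈ edges) (sym (orient-> y<x))
    (∈-filter⁺ oriented-edge? (∈-cartesianProduct⁺ (∈-allFin y) (∈-allFin x)) (y<x , adj-sym xy))

  colouring : Colourable 13 edges → Graph.InjectiveEdgeColoring G 13
  colouring (c , proper) = record
    { colour    = λ u v _ → c (orient (u , v))
    ; symmetric = λ u v p _ → cong c (orient-comm (adj⇒≢ p))
    ; proper    = λ a b c d p q k → proper (orient∈edges p) (orient∈edges q) (conf-orient {a} {b} {c} {d} k)
    }

theorem1p2 : (n : ℕ) (G : Graph n) → Graph.ClawFree G →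
    Graph.MaxDegreeAtMost G 4 → Graph.InjectiveEdgeColoring G 13
theorem1p2 n G claw-free Δ≤4 = colouring (colourable edges (<-wellFounded _) edges! edges-oriented)
  where
  open ConflictGraph G
  open ClawFree claw-free Δ≤4
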